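{- Let $n\ge 1$ and let $\mathcal{H}\subseteq \binom{[n]}{\le 3}$ be a downset. Then $\mathcal{H}$ is EKR. Moreover, $\mathcal{H}$ is strictly EKR, unless one of the following holds. (1) There is a subset $K\in\binom{[n]}{4}$ such that (i) $\binom{K}{3}\subseteq\mathcal{H}$, (ii) for all $H\in\mathcal{H}$, $H\subseteq K$ or $K\cap H=\emptyset$, and (iii) the largest star in $\mathcal{H}$ has size $7$. (2) There are subsets $K\in\binom{[n]}{3}$ and (possibly empty) $M\subseteq[n]\setminus K$ such that the family $$\mathcal{Z}=\binom{K}{2}\cup\left\{Z\in\binom{K\cup M}{3} : |Z\cap K|=2\right\}$$ satisfies $\mathcal{Z}\subseteq\mathcal{H}$, and either (i) $K\notin\mathcal{H}$ and the largest star in $\mathcal{H}$ has size $|\mathcal{Z}|=3|M|+3$, or (ii) $K\in\mathcal{H}$ and the largest star in $\mathcal{H}$ has size $|\mathcal{Z}|+1=3|M|+4$.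
   Context: $[n]=\{1,\ldots,n\}$. For a finite set $X$, $\binom{X}{k}$ is the family of all $k$-element subsets of $X$, and $\binom{[n]}{\le r}$ is the family of all subsets of $[n]$ of size at most $r$. A family $\mathcal{F}\subseteq 2^{[n]}$ is a downset if $A\in\mathcal{F}$ and $B\subseteq A$ imply $B\in\mathcal{F}$. A family $\mathcal{F}$ is intersecting if $A\cap B\ne\emptyset$ for every $A,B\in\mathcal{F}$ (including $A=B$, so an intersecting family does not contain $\emptyset$). For $\mathcal{F}\subseteq 2^{[n]}$ and $x\in[n]$, the $\mathcal{F}$-star centered at $x$ is $\mathcal{F}_x=\{A\in\mathcal{F}: x\in A\}$. The largest star in $\mathcal{H}$ is an $\mathcal{H}$-star $\mathcal{H}_x$ of maximum size over $x\in[n]$. Let $\iota(\mathcal{F})$ be the size of the largest intersecting subfamily of $\mathcal{F}$, and $\sigma(\mathcal{F})=\max_{x\in[n]}|\mathcal{F}_x|$. The family $\mathcal{F}$ is EKR if $\iota(\mathcal{F})=\sigma(\mathcal{F})$. It is strictly EKR if, moreover, all of the largest (maximum-size) intersecting subfamilies of $\mathcal{F}$ are $\mathcal{F}$-stars. -}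

module Defs where

open import Data.Fin using (Fin)
open import Data.Fin.Subset
  using (Subset; inside; outside; ∣_∣; _∩_; _∪_; Nonempty)
  renaming (_∈_ to _∈ₛ_; _⊆_ to _⊆ₛ_)
open import Data.Fin.Subset.Properties
  using () renaming (_∈?_ to _∈ₛ?_; _⊆?_ to _⊆ₛ?_)
open import Data.List using (List; []; _∷_; _++_; map; filter; length; allFin)
open import Data.List.Extrema.Nat using (max)
open import Data.Nat using (ℕ; zero; suc; _≤_; _≤?_; _≟_)
open import Data.Product using (∃; _×_)
import Data.Vec as Vec
open import Level using (0ℓ)
open import Relation.Binary.PropositionalEquality using (_≡_)
open import Relation.Nullary.Decidable using (_×-dec_; _⊎-dec_)
import Relation.Unary as U
open import Data.Sum using (_⊎_)

-- [n] is Fin n.  Membership is required to be decidable so that every family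
-- has a cardinality; its proofs need not be unique, hence families are compared
-- by mutual inclusion.
record Family (n : ℕ) : Set₁ where
  field
    Mem  : U.Pred (Subset n) 0ℓ
    mem? : U.Decidable Mem

open Family public

infix 4 _∈_ _∉_ _⊆_ _≐_

_∈_ _∉_ : ∀ {n} → Subset n → Family n → Set
A ∈ F = Mem F A
A ∉ F = A U.∉ Mem F

_⊆_ _≐_ : ∀ {n} → Family n → Family n → Set
F ⊆ G = Mem F U.⊆ Mem G
F ≐ G = Mem F U.≐ Mem G

-- Every subset of [n], listed exactly once.
allSubsets : ∀ n → List (Subset n)
allSubsets zero    = Vec.[] ∷ []
allSubsets (suc n) =
  map (outside Vec.∷_) (allSubsets n) ++ map (inside Vec.∷_) (allSubsets n)

size : ∀ {n} → Family n → ℕ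
size {n} F = length (filter (mem? F) (allSubsets n))

binom : ∀ {n} → Subset n → ℕ → Family n
binom X k .Mem  A = A ⊆ₛ X × ∣ A ∣ ≡ k
binom X k .mem? A = A ⊆ₛ? X ×-dec ∣ A ∣ ≟ k

atMost : ∀ n → ℕ → Family n
atMost n r .Mem  A = ∣ A ∣ ≤ r
atMost n r .mem? A = ∣ A ∣ ≤? r

Downset : ∀ {n} → Family n → Set
Downset F = ∀ {A B} → A ∈ F → B ⊆ₛ A → B ∈ F

-- A and B may coincide, so an intersecting family omits the empty set.
Intersecting : ∀ {n} → Family n → Set
Intersecting F = ∀ {A B} → A ∈ F → B ∈ F → Nonempty (A ∩ B)

star : ∀ {n} → Family n → Fin n → Family n
star F x .Mem  A = A ∈ F × x ∈ₛ A
star F x .mem? A = mem? F A ×-dec x ∈ₛ? A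

-- The default value 0 matters only when n = 0.
σ : ∀ {n} → Family n → ℕ
σ {n} F = max 0 (map (λ x → size (star F x)) (allFin n))

IntersectingSubfamily : ∀ {n} → Family n → Family n → Set
IntersectingSubfamily F G = G ⊆ F × Intersecting G

LargestIntersecting : ∀ {n} → Family n → Family n → Set₁
LargestIntersecting F G =
  IntersectingSubfamily F G × (∀ G′ → IntersectingSubfamily F G′ → size G′ ≤ size G)

-- ι is given by its graph: "ι F ≔ m" says that the largest intersecting
-- subfamilies of F have size m (which determines m).
infix 4 ι_≔_
ι_≔_ : ∀ {n} → Family n → ℕ → Set₁
ι F ≔ m = ∃ λ G → LargestIntersecting F G × size G ≡ m

EKR : ∀ {n} → Family n → Set₁
EKR F = ι F ≔ σ F

StrictlyEKR : ∀ {n} → Family n → Set₁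
StrictlyEKR F = EKR F × (∀ G → LargestIntersecting F G → ∃ λ x → G ≐ star F x)

𝒵 : ∀ {n} → Subset n → Subset n → Family n
𝒵 K M .Mem  Z = Z ∈ binom K 2 ⊎ (Z ∈ binom (K ∪ M) 3 × ∣ Z ∩ K ∣ ≡ 2)
𝒵 K M .mem? Z = mem? (binom K 2) Z ⊎-dec (mem? (binom (K ∪ M) 3) Z ×-dec ∣ Z ∩ K ∣ ≟ 2)

{-# OPTIONS --safe #-}
-- Let F be an intersecting subfamily of H that lies in no star and is at least
-- as large as every star.  Comparing F with the star at x, the members of that
-- star outside F are at most as many as the members of F avoiding x (the
-- exchange inequality).  Small sets {x}, {x,v} below members of F but not in F
-- populate the first side, so each use forces more members of F avoiding x.
--
-- If every pair in F equals {x,y} and at most one member of F avoids both x and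
-- y, the sets through x only and through y only form two cross-intersecting
-- graphs A and B; the exchange inequality makes |B| exceed the number of
-- vertices of A and vice versa, so both graphs become large, hence stars with a
-- common centre, where counting gives a contradiction.  If F is 3-uniform, this
-- excludes three members through a pair, then two, and linear F is excluded
-- directly.  If F contains two pairs, it contains a triangle of pairs (which
-- leads to the family 𝒵) or three pairs {x,y}, {x,u}, {x,v} (where F has seven
-- members, all determined), or it is excluded by counting again.
module Submission where

open import Defs
open import Data.Bool using (true; false)
import Data.Bool.Properties as Bool
open import Data.Empty using (⊥-elim) renaming (⊥ to Absurd)
open import Data.Fin using (Fin; zero; suc; fromℕ<)
open import Data.Fin.Properties using () renaming (_≟_ to _≟ᶠ_; any? to anyFin?)
open import Data.Fin.Subset
  using (Subset; inside; outside; ⊥; ⁅_⁆; ∣_∣; _∩_; _∪_; ∁; Empty)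
  renaming (_∈_ to _∈ₛ_; _∉_ to _∉ₛ_; _⊆_ to _⊆ₛ_)
open import Data.Fin.Subset.Properties
  using (∉⊥; x∈⁅x⁆; x∈⁅y⁆⇒x≡y; x∈p∪q⁺; x∈p∪q⁻; x∈p∩q⁺; x∈p∩q⁻; ∪-identityˡ;
         ⊆-antisym; p⊆q⇒∣p∣≤∣q∣; p⊂q⇒∣p∣<∣q∣; ∣⊥∣≡0; x∉p⇒x∈∁p; anySubset?)
  renaming (_∈?_ to _∈ₛ?_)
open import Data.List using (List; []; _∷_; _++_; map; filter; length; allFin)
open import Data.List.Extrema.Nat using (argmax; xs≤max; max≤v⁺; f[xs]≤f[argmax])
open import Data.List.Membership.DecPropositional using () renaming (_∈?_ to mem-list?)
open import Data.List.Membership.Propositional using () renaming (_∈_ to _∈ˡ_; _∉_ to _∉ˡ_)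
open import Data.List.Membership.Propositional.Properties
  using (∈-map⁺; ∈-map⁻; ∈-++⁺ˡ; ∈-++⁺ʳ; ∈-++⁻; ∈-filter⁺; ∈-filter⁻; ∈-∃++; ∈-allFin)
open import Data.List.Properties using (length-++; length-map)
open import Data.List.Relation.Unary.All as All using (All; []; _∷_)
import Data.List.Relation.Unary.All.Properties as All
open import Data.List.Relation.Unary.All.Properties using (¬Any⇒All¬; All¬⇒¬Any)
open import Data.List.Relation.Unary.AllPairs using ([]; _∷_)
open import Data.List.Relation.Unary.Any using (here; there)
open import Data.List.Relation.Unary.Unique.Propositional using (Unique)
import Data.List.Relation.Unary.Unique.Propositional.Properties as Uniq
open import Data.Nat using (ℕ; zero; suc; _+_; _*_; _≤_; _<_; _≥_; z≤n; s≤s)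
open import Data.Nat.Properties
open import Data.Product using (∃-syntax; _×_; _,_; proj₁; proj₂)
open import Data.Sum as Sum using (_⊎_; inj₁; inj₂; [_,_]′)
import Data.Vec as Vec
import Data.Vec.Properties as Vec
open import Function using (_∘_; id)
open import Relation.Binary.PropositionalEquality
  using (_≡_; _≢_; refl; sym; trans; cong; cong₂; subst; ≢-sym; module ≡-Reasoning)
open import Relation.Nullary using (¬_; Dec; yes; no; ¬?)
open import Relation.Nullary.Decidable using (_×-dec_; _⊎-dec_; map′; decidable-stable)
open import Relation.Unary using (Decidable)

private
  variable
    n : ℕ
    X : Set

-- Counting in lists and families

unique-⊆⇒length≤ : {xs ys : List X} → Unique xs → (∀ {x} → x ∈ˡ xs → x ∈ˡ ys) →
                   length xs ≤ length ys
unique-⊆⇒length≤ {xs = []} _ _ = z≤n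
unique-⊆⇒length≤ {xs = x ∷ xs} (x∉xs ∷ u) xs⊆ with ∈-∃++ (xs⊆ (here refl))
... | ys , zs , refl = begin
    suc (length xs)                ≤⟨ s≤s (unique-⊆⇒length≤ u without) ⟩
    suc (length (ys ++ zs))        ≡⟨ cong suc (length-++ ys) ⟩
    suc (length ys + length zs)    ≡⟨ sym (+-suc (length ys) (length zs)) ⟩
    length ys + suc (length zs)    ≡⟨ sym (length-++ ys) ⟩
    length (ys ++ x ∷ zs)          ∎
  where
  open ≤-Reasoning
  without : ∀ {y} → y ∈ˡ xs → y ∈ˡ ys ++ zs
  without y∈ with ∈-++⁻ ys (xs⊆ (there y∈))
  ... | inj₁ p = ∈-++⁺ˡ p
  ... | inj₂ (here refl) = ⊥-elim (All.lookup x∉xs y∈ refl)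
  ... | inj₂ (there p) = ∈-++⁺ʳ ys p

-- An `i` with `Q i` but not `P i` could be put in front of the list for `P`, giving a
-- duplicate-free part of the list for `Q` that is too long.
filter-length-≤⇒⊆ : {P Q : Fin n → Set} (P? : Decidable P) (Q? : Decidable Q) →
  (∀ {i} → P i → Q i) →
  length (filter Q? (allFin n)) ≤ length (filter P? (allFin n)) → ∀ {i} → Q i → P i
filter-length-≤⇒⊆ {n} P? Q? P⇒Q Q≤P {i} qi with P? i
... | yes pi = pi
... | no ¬pi = ⊥-elim (<⇒≱ (unique-⊆⇒length≤ (fresh ∷ Uniq.filter⁺ P? (Uniq.allFin⁺ n)) incl) Q≤P)
  where
  fresh : All (i ≢_) (filter P? (allFin n))
  fresh = All.tabulate λ { j∈ refl → ¬pi (proj₂ (∈-filter⁻ P? {xs = allFin n} j∈)) }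
  incl : ∀ {j} → j ∈ˡ i ∷ filter P? (allFin n) → j ∈ˡ filter Q? (allFin n)
  incl (here refl) = ∈-filter⁺ Q? (∈-allFin i) qi
  incl (there j∈) = ∈-filter⁺ Q? (∈-allFin _) (P⇒Q (proj₂ (∈-filter⁻ P? {xs = allFin n} j∈)))

∈-allSubsets : (S : Subset n) → S ∈ˡ allSubsets n
∈-allSubsets Vec.[] = here refl
∈-allSubsets (false Vec.∷ S) = ∈-++⁺ˡ (∈-map⁺ _ (∈-allSubsets S))
∈-allSubsets (true Vec.∷ S) = ∈-++⁺ʳ _ (∈-map⁺ _ (∈-allSubsets S))

allSubsets-unique : ∀ n → Unique (allSubsets n)
allSubsets-unique zero = [] ∷ []
allSubsets-unique (suc n) =
  Uniq.++⁺ (Uniq.map⁺ (λ { refl → refl }) u) (Uniq.map⁺ (λ { refl → refl }) u) disjoint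
  where
  u = allSubsets-unique n
  disjoint : ∀ {S} → ¬ (S ∈ˡ map (outside Vec.∷_) (allSubsets n)
                        × S ∈ˡ map (inside Vec.∷_) (allSubsets n))
  disjoint (p , q) with ∈-map⁻ _ p | ∈-map⁻ _ q
  ... | _ , _ , refl | _ , _ , ()

members : Family n → List (Subset n)
members {n} P = filter (mem? P) (allSubsets n)

∈-members⁺ : (P : Family n) {S : Subset n} → S ∈ P → S ∈ˡ members P
∈-members⁺ P S∈ = ∈-filter⁺ (mem? P) (∈-allSubsets _) S∈

∈-members⁻ : (P : Family n) {S : Subset n} → S ∈ˡ members P → S ∈ P
∈-members⁻ {n} P S∈ = proj₂ (∈-filter⁻ (mem? P) {xs = allSubsets n} S∈)

members-unique : (P : Family n) → Unique (members P)
members-unique {n} P = Uniq.filter⁺ (mem? P) (allSubsets-unique n)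

-- Differences of families are compared without subtraction: `L` is part of `Q` minus `P`, and `L′`
-- covers `P` minus `Q`.
size-exchange : (P Q : Family n) (L L′ : List (Subset n)) → Unique L →
  (∀ {S} → S ∈ˡ L → S ∈ Q × S ∉ P) → (∀ {S} → S ∈ P → S ∈ Q ⊎ S ∈ˡ L′) →
  size P + length L ≤ size Q + length L′
size-exchange P Q L L′ u L⊆ P⊆ = begin
    size P + length L         ≡⟨ sym (length-++ (members P)) ⟩
    length (members P ++ L)   ≤⟨ unique-⊆⇒length≤
                                   (Uniq.++⁺ (members-unique P) u λ { (p , q) → proj₂ (L⊆ q) (∈-members⁻ P p) })
                                   incl ⟩
    length (members Q ++ L′)  ≡⟨ length-++ (members Q) ⟩
    size Q + length L′        ∎
  where
  open ≤-Reasoning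
  incl : ∀ {S} → S ∈ˡ members P ++ L → S ∈ˡ members Q ++ L′
  incl S∈ with ∈-++⁻ (members P) S∈
  ... | inj₂ q = ∈-++⁺ˡ (∈-members⁺ Q (proj₁ (L⊆ q)))
  ... | inj₁ p with P⊆ (∈-members⁻ P p)
  ...   | inj₁ S∈Q = ∈-++⁺ˡ (∈-members⁺ Q S∈Q)
  ...   | inj₂ S∈L = ∈-++⁺ʳ (members Q) S∈L

size-list : (P : Family n) (L : List (Subset n)) → Unique L →
  (∀ {S} → S ∈ˡ L → S ∈ P) → (∀ {S} → S ∈ P → S ∈ˡ L) → size P ≡ length L
size-list P L u L⊆ P⊆ = ≤-antisym
  (unique-⊆⇒length≤ (members-unique P) (P⊆ ∘ ∈-members⁻ P))
  (unique-⊆⇒length≤ u (∈-members⁺ P ∘ L⊆))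

-- Sets given by lists of elements

opaque
  ⟦_⟧ : List (Fin n) → Subset n
  ⟦ [] ⟧ = ⊥
  ⟦ x ∷ l ⟧ = ⁅ x ⁆ ∪ ⟦ l ⟧

  ∈⟦⟧⁺ : ∀ {x : Fin n} {l} → x ∈ˡ l → x ∈ₛ ⟦ l ⟧
  ∈⟦⟧⁺ (here refl) = x∈p∪q⁺ (inj₁ (x∈⁅x⁆ _))
  ∈⟦⟧⁺ (there x∈) = x∈p∪q⁺ (inj₂ (∈⟦⟧⁺ x∈))

  ∈⟦⟧⁻ : ∀ {x : Fin n} l → x ∈ₛ ⟦ l ⟧ → x ∈ˡ l
  ∈⟦⟧⁻ [] x∈ = ⊥-elim (∉⊥ x∈)
  ∈⟦⟧⁻ (y ∷ l) x∈ with x∈p∪q⁻ ⁅ y ⁆ ⟦ l ⟧ x∈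
  ... | inj₁ p = here (x∈⁅y⁆⇒x≡y y p)
  ... | inj₂ q = there (∈⟦⟧⁻ l q)

⟦⟧-⊆ : ∀ {l} {S : Subset n} → All (_∈ₛ S) l → ⟦ l ⟧ ⊆ₛ S
⟦⟧-⊆ {l = l} l⊆ x∈ = All.lookup l⊆ (∈⟦⟧⁻ l x∈)

⟦⟧-cong : ∀ {k l : List (Fin n)} → All (_∈ˡ l) k → All (_∈ˡ k) l → ⟦ k ⟧ ≡ ⟦ l ⟧
⟦⟧-cong p q = ⊆-antisym (⟦⟧-⊆ (All.map ∈⟦⟧⁺ p)) (⟦⟧-⊆ (All.map ∈⟦⟧⁺ q))

∣⁅x⁆∪p∣≤ : (x : Fin n) (p : Subset n) → ∣ ⁅ x ⁆ ∪ p ∣ ≤ suc ∣ p ∣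
∣⁅x⁆∪p∣≤ zero (s Vec.∷ p) rewrite ∪-identityˡ p with s
... | true = n≤1+n _
... | false = ≤-refl
∣⁅x⁆∪p∣≤ (suc x) (true Vec.∷ p) = s≤s (∣⁅x⁆∪p∣≤ x p)
∣⁅x⁆∪p∣≤ (suc x) (false Vec.∷ p) = ∣⁅x⁆∪p∣≤ x p

opaque
  unfolding ⟦_⟧

  ∣⟦⟧∣≤ : (l : List (Fin n)) → ∣ ⟦ l ⟧ ∣ ≤ length l
  ∣⟦⟧∣≤ {n} [] = ≤-reflexive (∣⊥∣≡0 n)
  ∣⟦⟧∣≤ (x ∷ l) = ≤-trans (∣⁅x⁆∪p∣≤ x ⟦ l ⟧) (s≤s (∣⟦⟧∣≤ l))

  ≤∣⟦⟧∣ : ∀ {l : List (Fin n)} → Unique l → length l ≤ ∣ ⟦ l ⟧ ∣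
  ≤∣⟦⟧∣ [] = z≤n
  ≤∣⟦⟧∣ {l = x ∷ l} (x∉ ∷ u) = ≤-<-trans (≤∣⟦⟧∣ u) (p⊂q⇒∣p∣<∣q∣
    ( (λ y∈ → x∈p∪q⁺ (inj₂ y∈)) , x , x∈p∪q⁺ (inj₁ (x∈⁅x⁆ x))
    , λ x∈ → All.lookup x∉ (∈⟦⟧⁻ l x∈) refl))

∣⟦⟧∣ : ∀ {l : List (Fin n)} → Unique l → ∣ ⟦ l ⟧ ∣ ≡ length l
∣⟦⟧∣ {l = l} u = ≤-antisym (∣⟦⟧∣≤ l) (≤∣⟦⟧∣ u)

unique⇒length≤∣∣ : ∀ {l} {S : Subset n} → Unique l → All (_∈ₛ S) l → length l ≤ ∣ S ∣
unique⇒length≤∣∣ u l⊆ = ≤-trans (≤∣⟦⟧∣ u) (p⊆q⇒∣p∣≤∣q∣ (⟦⟧-⊆ l⊆))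

⊆∧≥⇒≡ : {p q : Subset n} → p ⊆ₛ q → ∣ q ∣ ≤ ∣ p ∣ → p ≡ q
⊆∧≥⇒≡ {p = p} {q} p⊆q q≤p = ⊆-antisym p⊆q λ {v} v∈q →
  decidable-stable (v ∈ₛ? p) λ v∉p → <⇒≱ (p⊂q⇒∣p∣<∣q∣ (p⊆q , v , v∈q , v∉p)) q≤p

⟦⟧-full : ∀ {l} {S : Subset n} → Unique l → All (_∈ₛ S) l → ∣ S ∣ ≤ length l → S ≡ ⟦ l ⟧
⟦⟧-full u l⊆ S≤ = sym (⊆∧≥⇒≡ (⟦⟧-⊆ l⊆) (≤-trans S≤ (≤∣⟦⟧∣ u)))

further-element : ∀ {l} {S : Subset n} → All (_∈ₛ S) l → S ≢ ⟦ l ⟧ →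
         ∃[ v ] v ∈ₛ S × All (v ≢_) l
further-element {l = l} {S} l⊆ S≢ with anyFin? (λ v → v ∈ₛ? S ×-dec ¬? (v ∈ₛ? ⟦ l ⟧))
... | yes (v , v∈ , v∉) = v , v∈ , All.tabulate λ { w∈ refl → v∉ (∈⟦⟧⁺ w∈) }
... | no none = ⊥-elim (S≢ (⊆-antisym
        (λ {v} v∈ → decidable-stable (v ∈ₛ? ⟦ l ⟧) λ v∉ → none (v , v∈ , v∉)) (⟦⟧-⊆ l⊆)))

-- Pairs and triples

pattern 0ᵗʰ = here refl
pattern 1ˢᵗ = there 0ᵗʰ
pattern 2ⁿᵈ = there 1ˢᵗ
pattern 3ʳᵈ = there 2ⁿᵈ

module _ {n : ℕ} where

  -- The vertices may coincide: `π a a` is the singleton of `a`, so one notation serves singletons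
  -- and pairs.
  π : Fin n → Fin n → Subset n
  π a b = ⟦ a ∷ b ∷ [] ⟧

  τ : Fin n → Fin n → Fin n → Subset n
  τ a b c = ⟦ a ∷ b ∷ c ∷ [] ⟧

  opaque
    π-swap : ∀ a b → π a b ≡ π b a
    π-swap a b = ⟦⟧-cong (1ˢᵗ ∷ 0ᵗʰ ∷ []) (1ˢᵗ ∷ 0ᵗʰ ∷ [])

  opaque
    π-injective : ∀ a {b c} → π a b ≡ π a c → b ≡ c
    π-injective a {b} {c} eq
      with ∈⟦⟧⁻ (a ∷ c ∷ []) (subst (b ∈ₛ_) eq (∈⟦⟧⁺ 1ˢᵗ))
         | ∈⟦⟧⁻ (a ∷ b ∷ []) (subst (c ∈ₛ_) (sym eq) (∈⟦⟧⁺ 1ˢᵗ))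
    ... | 1ˢᵗ | _ = refl
    ... | 0ᵗʰ | 0ᵗʰ = refl
    ... | 0ᵗʰ | 1ˢᵗ = refl

  _∉⇒All_ : ∀ {v : Fin n} {S : Subset n} {l} → v ∉ₛ S → All (_∈ₛ S) l → All (v ≢_) l
  v∉ ∉⇒All l⊆ = All.map (λ { w∈ refl → v∉ w∈ }) l⊆

  infix 4 _≟ˢ_
  _≟ˢ_ : (S T : Subset n) → Dec (S ≡ T)
  _≟ˢ_ = Vec.≡-dec Bool._≟_

  fresh? : (S : Subset n) (L : List (Subset n)) → Dec (All (S ≢_) L)
  fresh? S L = All.all? (λ T → ¬? (S ≟ˢ T)) L

  ¬fresh⇒∈ : ∀ {S : Subset n} {L} → ¬ All (S ≢_) L → S ∈ˡ L
  ¬fresh⇒∈ {S} {L} ¬f = decidable-stable (mem-list? _≟ˢ_ S L) (¬f ∘ ¬Any⇒All¬ L)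

-- The family `𝒵` as three disjoint lists

module _ {n : ℕ} where

  -- For a triple `K` through distinct `a` and `b`, and `W` disjoint from `K`, these are the members
  -- of `𝒵 K ⟦ W ⟧` that meet `K` exactly in `a` and `b`.
  spans : Fin n → Fin n → List (Fin n) → List (Subset n)
  spans a b W = π a b ∷ map (τ a b) W

  opaque
    spans-shape : ∀ {a b W Z} → Z ∈ˡ spans a b W → Z ≡ π a b ⊎ ∃[ m ] m ∈ˡ W × Z ≡ τ a b m
    spans-shape (here eq) = inj₁ eq
    spans-shape (there Z∈) = inj₂ (∈-map⁻ _ Z∈)

  opaque
    spans-excludes : ∀ {a b c W Z} → c ≢ a → c ≢ b → c ∉ˡ W → Z ∈ˡ spans a b W → c ∉ₛ Z
    spans-excludes {a} {b} c≢a c≢b c∉ Z∈ c∈ with spans-shape Z∈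
    ... | inj₁ refl with ∈⟦⟧⁻ (a ∷ b ∷ []) c∈
    ...   | 0ᵗʰ = c≢a refl
    ...   | 1ˢᵗ = c≢b refl
    spans-excludes {a} {b} c≢a c≢b c∉ Z∈ c∈ | inj₂ (m , m∈ , refl) with ∈⟦⟧⁻ (a ∷ b ∷ m ∷ []) c∈
    ...   | 0ᵗʰ = c≢a refl
    ...   | 1ˢᵗ = c≢b refl
    ...   | 2ⁿᵈ = c∉ m∈

  opaque
    spans-contains : ∀ {a b W Z} → Z ∈ˡ spans a b W → a ∈ₛ Z × b ∈ₛ Z
    spans-contains Z∈ with spans-shape Z∈
    ... | inj₁ refl = ∈⟦⟧⁺ 0ᵗʰ , ∈⟦⟧⁺ 1ˢᵗ
    ... | inj₂ (_ , _ , refl) = ∈⟦⟧⁺ 0ᵗʰ , ∈⟦⟧⁺ 1ˢᵗ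

  opaque
    τ-cancel : ∀ {a b c d : Fin n} → τ a b c ≡ τ a b d → c ≢ a → c ≢ b → c ≡ d
    τ-cancel {a} {b} {c} {d} eq c≢a c≢b
      with ∈⟦⟧⁻ (a ∷ b ∷ d ∷ []) (subst (c ∈ₛ_) eq (∈⟦⟧⁺ 2ⁿᵈ))
    ... | 0ᵗʰ = ⊥-elim (c≢a refl)
    ... | 1ˢᵗ = ⊥-elim (c≢b refl)
    ... | 2ⁿᵈ = refl

  opaque
    spans-unique : ∀ {a b W} → Unique W → a ∉ˡ W → b ∉ˡ W → Unique (spans a b W)
    spans-unique {a} {b} {W} u a∉ b∉ = All.tabulate fresh ∷ unique-map u a∉ b∉
      where
      fresh : ∀ {Z} → Z ∈ˡ map (τ a b) W → π a b ≢ Z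
      fresh Z∈ eq with ∈-map⁻ _ Z∈
      ... | m , m∈ , refl with ∈⟦⟧⁻ (a ∷ b ∷ []) (subst (m ∈ₛ_) (sym eq) (∈⟦⟧⁺ 2ⁿᵈ))
      ...   | 0ᵗʰ = a∉ m∈
      ...   | 1ˢᵗ = b∉ m∈
      unique-map : ∀ {V} → Unique V → a ∉ˡ V → b ∉ˡ V → Unique (map (τ a b) V)
      unique-map [] _ _ = []
      unique-map {V = v ∷ V} (v∉ ∷ uV) a∉ b∉ = All.tabulate apart ∷ unique-map uV (a∉ ∘ there) (b∉ ∘ there)
        where
        apart : ∀ {Z} → Z ∈ˡ map (τ a b) V → τ a b v ≢ Z
        apart Z∈ eq with ∈-map⁻ _ Z∈
        ... | m , m∈ , refl = All.lookup v∉ m∈ (τ-cancel eq (λ { refl → a∉ 0ᵗʰ }) (λ { refl → b∉ 0ᵗʰ }))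

  opaque
    spans⊆𝒵 : ∀ {a b K W Z} → a ≢ b → a ∈ₛ K → b ∈ₛ K → (∀ {m} → m ∈ˡ W → m ∉ₛ K) →
              Z ∈ˡ spans a b W → Z ∈ 𝒵 K ⟦ W ⟧
    spans⊆𝒵 a≢b a∈ b∈ W∉ Z∈ with spans-shape Z∈
    ... | inj₁ refl = inj₁ (⟦⟧-⊆ (a∈ ∷ b∈ ∷ []) , ∣⟦⟧∣ ((a≢b ∷ []) ∷ [] ∷ []))
    spans⊆𝒵 {a} {b} {K} {W} a≢b a∈ b∈ W∉ Z∈ | inj₂ (m , m∈ , refl) = inj₂
      ( ( ⟦⟧-⊆ (x∈p∪q⁺ (inj₁ a∈) ∷ x∈p∪q⁺ (inj₁ b∈) ∷ x∈p∪q⁺ (inj₂ (∈⟦⟧⁺ m∈)) ∷ [])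
        , ∣⟦⟧∣ ((a≢b ∷ (λ { refl → W∉ m∈ a∈ }) ∷ []) ∷ ((λ { refl → W∉ m∈ b∈ }) ∷ []) ∷ [] ∷ []))
      , trans (cong ∣_∣ meet≡) (∣⟦⟧∣ ((a≢b ∷ []) ∷ [] ∷ [])))
      where
      below : τ a b m ∩ K ⊆ₛ π a b
      below v∈ with x∈p∩q⁻ (τ a b m) K v∈
      ... | v∈τ , v∈K with ∈⟦⟧⁻ (a ∷ b ∷ m ∷ []) v∈τ
      ...   | 0ᵗʰ = ∈⟦⟧⁺ 0ᵗʰ
      ...   | 1ˢᵗ = ∈⟦⟧⁺ 1ˢᵗ
      ...   | 2ⁿᵈ = ⊥-elim (W∉ m∈ v∈K)
      meet≡ : τ a b m ∩ K ≡ π a b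
      meet≡ = ⊆-antisym below (⟦⟧-⊆ (x∈p∩q⁺ (∈⟦⟧⁺ 0ᵗʰ , a∈) ∷ x∈p∩q⁺ (∈⟦⟧⁺ 1ˢᵗ , b∈) ∷ []))

  opaque
    -- Having three elements, `Z` has one beyond `a` and `b`; it is not in `K`, as `Z ∩ K` is only
    -- the pair, and so comes from `W`.
    spans-from : ∀ {a b K W Z} → a ≢ b → Z ⊆ₛ K ∪ ⟦ W ⟧ → ∣ Z ∣ ≡ 3 → Z ∩ K ≡ π a b → Z ∈ˡ spans a b W
    spans-from {a} {b} {K} {W} {Z} a≢b Z⊆ ∣Z∣ eq = result
      where
      in-Z : ∀ {v} → v ∈ₛ π a b → v ∈ₛ Z
      in-Z {v} v∈ = proj₁ (x∈p∩q⁻ Z K (subst (v ∈ₛ_) (sym eq) v∈))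
      result : Z ∈ˡ spans a b W
      result with further-element (in-Z (∈⟦⟧⁺ 0ᵗʰ) ∷ in-Z (∈⟦⟧⁺ 1ˢᵗ) ∷ [])
                    (λ { refl → <⇒≱ (≤-reflexive (sym ∣Z∣)) (∣⟦⟧∣≤ (a ∷ b ∷ [])) })
      ... | m , m∈ , m≢@(m≢a ∷ m≢b ∷ []) with x∈p∪q⁻ K ⟦ W ⟧ (Z⊆ m∈)
      ...   | inj₁ m∈K = ⊥-elim (All¬⇒¬Any m≢
                (∈⟦⟧⁻ (a ∷ b ∷ []) (subst (m ∈ₛ_) eq (x∈p∩q⁺ (m∈ , m∈K)))))
      ...   | inj₂ m∈W = there (subst (_∈ˡ map (τ a b) W)
                (sym (⟦⟧-full ((a≢b ∷ ≢-sym m≢a ∷ []) ∷ (≢-sym m≢b ∷ []) ∷ [] ∷ [])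
                  (in-Z (∈⟦⟧⁺ 0ᵗʰ) ∷ in-Z (∈⟦⟧⁺ 1ˢᵗ) ∷ m∈ ∷ []) (≤-reflexive ∣Z∣)))
                (∈-map⁺ (τ a b) (∈⟦⟧⁻ W m∈W)))

  module _ {x y u : Fin n} (x≢y : x ≢ y) (x≢u : x ≢ u) (y≢u : y ≢ u) where

    opaque
      pairs-of-triple : ∀ {P} → P ⊆ₛ τ x y u → ∣ P ∣ ≡ 2 → P ≡ π x y ⊎ P ≡ π x u ⊎ P ≡ π y u
      pairs-of-triple {P} P⊆ ∣P∣ with x ∈ₛ? P | y ∈ₛ? P | u ∈ₛ? P
      ... | yes x∈ | yes y∈ | _ = inj₁ (⟦⟧-full ((x≢y ∷ []) ∷ [] ∷ []) (x∈ ∷ y∈ ∷ []) (≤-reflexive ∣P∣))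
      ... | yes x∈ | no _ | yes u∈ = inj₂ (inj₁ (⟦⟧-full ((x≢u ∷ []) ∷ [] ∷ []) (x∈ ∷ u∈ ∷ []) (≤-reflexive ∣P∣)))
      ... | no _ | yes y∈ | yes u∈ = inj₂ (inj₂ (⟦⟧-full ((y≢u ∷ []) ∷ [] ∷ []) (y∈ ∷ u∈ ∷ []) (≤-reflexive ∣P∣)))
      ... | no x∉ | no y∉ | _ = ⊥-elim (<⇒≱ (≤-reflexive (sym ∣P∣)) (≤-trans (p⊆q⇒∣p∣≤∣q∣ below) (∣⟦⟧∣≤ (u ∷ []))))
        where
        below : P ⊆ₛ ⟦ u ∷ [] ⟧
        below v∈ with ∈⟦⟧⁻ (x ∷ y ∷ u ∷ []) (P⊆ v∈)
        ... | 0ᵗʰ = ⊥-elim (x∉ v∈)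
        ... | 1ˢᵗ = ⊥-elim (y∉ v∈)
        ... | 2ⁿᵈ = ∈⟦⟧⁺ 0ᵗʰ
      ... | no x∉ | yes _ | no u∉ = ⊥-elim (<⇒≱ (≤-reflexive (sym ∣P∣)) (≤-trans (p⊆q⇒∣p∣≤∣q∣ below) (∣⟦⟧∣≤ (y ∷ []))))
        where
        below : P ⊆ₛ ⟦ y ∷ [] ⟧
        below v∈ with ∈⟦⟧⁻ (x ∷ y ∷ u ∷ []) (P⊆ v∈)
        ... | 0ᵗʰ = ⊥-elim (x∉ v∈)
        ... | 1ˢᵗ = ∈⟦⟧⁺ 0ᵗʰ
        ... | 2ⁿᵈ = ⊥-elim (u∉ v∈)
      ... | yes _ | no y∉ | no u∉ = ⊥-elim (<⇒≱ (≤-reflexive (sym ∣P∣)) (≤-trans (p⊆q⇒∣p∣≤∣q∣ below) (∣⟦⟧∣≤ (x ∷ []))))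
        where
        below : P ⊆ₛ ⟦ x ∷ [] ⟧
        below v∈ with ∈⟦⟧⁻ (x ∷ y ∷ u ∷ []) (P⊆ v∈)
        ... | 0ᵗʰ = ∈⟦⟧⁺ 0ᵗʰ
        ... | 1ˢᵗ = ⊥-elim (y∉ v∈)
        ... | 2ⁿᵈ = ⊥-elim (u∉ v∈)

    module _ {W : List (Fin n)} (W-unique : Unique W) (W∉ : ∀ {m} → m ∈ˡ W → m ∉ₛ τ x y u) where

      𝒵-list : List (Subset n)
      𝒵-list = spans x y W ++ (spans x u W ++ spans y u W)

      opaque
        𝒵⇒spans : ∀ {Z} → Z ∈ 𝒵 (τ x y u) ⟦ W ⟧ → Z ∈ˡ spans x y W ⊎ Z ∈ˡ spans x u W ⊎ Z ∈ˡ spans y u W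
        𝒵⇒spans (inj₁ (Z⊆ , ∣Z∣)) =
          Sum.map here (Sum.map here here) (pairs-of-triple Z⊆ ∣Z∣)
        𝒵⇒spans {Z} (inj₂ ((Z⊆ , ∣Z∣) , ∣Z∩K∣)) =
          Sum.map (spans-from x≢y Z⊆ ∣Z∣) (Sum.map (spans-from x≢u Z⊆ ∣Z∣) (spans-from y≢u Z⊆ ∣Z∣))
            (pairs-of-triple (proj₂ ∘ x∈p∩q⁻ Z (τ x y u)) ∣Z∩K∣)

      opaque
        spans⇒𝒵 : ∀ {Z} → Z ∈ˡ spans x y W ⊎ Z ∈ˡ spans x u W ⊎ Z ∈ˡ spans y u W → Z ∈ 𝒵 (τ x y u) ⟦ W ⟧
        spans⇒𝒵 (inj₁ Z∈) = spans⊆𝒵 x≢y (∈⟦⟧⁺ 0ᵗʰ) (∈⟦⟧⁺ 1ˢᵗ) W∉ Z∈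
        spans⇒𝒵 (inj₂ (inj₁ Z∈)) = spans⊆𝒵 x≢u (∈⟦⟧⁺ 0ᵗʰ) (∈⟦⟧⁺ 2ⁿᵈ) W∉ Z∈
        spans⇒𝒵 (inj₂ (inj₂ Z∈)) = spans⊆𝒵 y≢u (∈⟦⟧⁺ 1ˢᵗ) (∈⟦⟧⁺ 2ⁿᵈ) W∉ Z∈

      opaque
        -- Each of the three pairs contributes itself and one triple per element of `W`; sets over
        -- different pairs are told apart by a vertex of `τ x y u`.
        size-𝒵 : size (𝒵 (τ x y u) ⟦ W ⟧) ≡ 3 * ∣ ⟦ W ⟧ ∣ + 3
        size-𝒵 = trans (size-list _ 𝒵-list unique
            (λ Z∈ → spans⇒𝒵 (Sum.map₂ (∈-++⁻ (spans x u W)) (∈-++⁻ (spans x y W) Z∈)))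
            (λ Z∈ → [ ∈-++⁺ˡ , [ ∈-++⁺ʳ (spans x y W) ∘ ∈-++⁺ˡ , ∈-++⁺ʳ (spans x y W) ∘ ∈-++⁺ʳ (spans x u W) ]′ ]′
                      (𝒵⇒spans Z∈)))
            count
          where
          x∉ : x ∉ˡ W
          x∉ m∈ = W∉ m∈ (∈⟦⟧⁺ 0ᵗʰ)
          y∉ : y ∉ˡ W
          y∉ m∈ = W∉ m∈ (∈⟦⟧⁺ 1ˢᵗ)
          u∉ : u ∉ˡ W
          u∉ m∈ = W∉ m∈ (∈⟦⟧⁺ 2ⁿᵈ)
          unique : Unique 𝒵-list
          unique = Uniq.++⁺ (spans-unique W-unique x∉ y∉)
            (Uniq.++⁺ (spans-unique W-unique x∉ u∉) (spans-unique W-unique y∉ u∉)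
              λ (p , q) → spans-excludes x≢y x≢u x∉ q (proj₁ (spans-contains p)))
            λ (p , q) → [ (λ r → spans-excludes (≢-sym x≢u) (≢-sym y≢u) u∉ p (proj₂ (spans-contains r)))
                        , (λ r → spans-excludes (≢-sym x≢u) (≢-sym y≢u) u∉ p (proj₂ (spans-contains r))) ]′
                        (∈-++⁻ (spans x u W) q)
          count : length 𝒵-list ≡ 3 * ∣ ⟦ W ⟧ ∣ + 3
          count = begin
            length 𝒵-list
              ≡⟨ trans (length-++ (spans x y W)) (cong (length (spans x y W) +_) (length-++ (spans x u W))) ⟩
            suc (length (map (τ x y) W)) + (suc (length (map (τ x u) W)) + suc (length (map (τ y u) W)))
              ≡⟨ cong₂ (λ i j → suc i + j) (length-map (τ x y) W)
                   (cong₂ (λ i j → suc i + suc j) (length-map (τ x u) W) (length-map (τ y u) W)) ⟩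
            suc k + (suc k + suc k)  ≡⟨ cong (suc k +_) (cong (suc k +_) (sym (+-identityʳ (suc k)))) ⟩
            3 * suc k                ≡⟨ *-suc 3 k ⟩
            3 + 3 * k                ≡⟨ +-comm 3 (3 * k) ⟩
            3 * k + 3                ≡⟨ cong (λ i → 3 * i + 3) (sym (∣⟦⟧∣ W-unique)) ⟩
            3 * ∣ ⟦ W ⟧ ∣ + 3        ∎
            where
            open ≡-Reasoning
            k : ℕ
            k = length W

-- The sizes speak of `F` and not of `σ H`, since they are established before `F` is known to be no
-- larger than the largest star; the last component supplies that bound.
Exceptional : ∀ {n} → Family n → Family n → Set
Exceptional H F = ∃[ K ] ∃[ M ] ∣ K ∣ ≡ 3 × M ⊆ₛ ∁ K × 𝒵 K M ⊆ H
  × size (𝒵 K M) ≡ 3 * ∣ M ∣ + 3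
  × ((K ∉ H × size F ≡ size (𝒵 K M)) ⊎ (K ∈ H × size F ≡ size (𝒵 K M) + 1))
  × ∃[ x ] size F ≤ size (star H x)

-- Intersecting families in no star: the exchange inequality

module NonStar {n : ℕ} (H F : Family n)
  (rank : H ⊆ atMost n 3) (down : Downset H) (F⊆H : F ⊆ H) (int : Intersecting F)
  (large : ∀ x → size (star H x) ≤ size F)
  (avoid : ∀ x → ∃[ S ] S ∈ F × x ∉ₛ S) where

  opaque
    meet : ∀ {S T} → S ∈ F → T ∈ F → ∃[ v ] v ∈ₛ S × v ∈ₛ T
    meet {S} {T} S∈ T∈ with int S∈ T∈
    ... | v , v∈ = v , x∈p∩q⁻ S T v∈

  opaque
    meets-list : ∀ l {T} → ⟦ l ⟧ ∈ F → T ∈ F → ∃[ v ] v ∈ˡ l × v ∈ₛ T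
    meets-list l S∈ T∈ with meet S∈ T∈
    ... | v , v∈l , v∈T = v , ∈⟦⟧⁻ l v∈l , v∈T

  opaque
    triple : ∀ {S a b c} → S ∈ F → a ≢ b → a ≢ c → b ≢ c → a ∈ₛ S → b ∈ₛ S → c ∈ₛ S → S ≡ τ a b c
    triple S∈ a≢b a≢c b≢c a∈ b∈ c∈ =
      ⟦⟧-full ((a≢b ∷ a≢c ∷ []) ∷ (b≢c ∷ []) ∷ [] ∷ []) (a∈ ∷ b∈ ∷ c∈ ∷ []) (rank (F⊆H S∈))

  opaque
    no-four : ∀ {S} {a b c d : Fin n} → S ∈ F → Unique (a ∷ b ∷ c ∷ d ∷ []) →
              All (_∈ₛ S) (a ∷ b ∷ c ∷ d ∷ []) → Absurd
    no-four S∈ u l⊆ = <⇒≱ (unique⇒length≤∣∣ u l⊆) (rank (F⊆H S∈))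

  opaque
    pair∈H : ∀ {S a b} → S ∈ F → a ∈ₛ S → b ∈ₛ S → π a b ∈ H
    pair∈H S∈ a∈ b∈ = down (F⊆H S∈) (⟦⟧-⊆ (a∈ ∷ b∈ ∷ []))

  opaque
    no-singleton : ∀ x → π x x ∉ F
    no-singleton x xx∈ with avoid x
    ... | S , S∈ , x∉ with meets-list (x ∷ x ∷ []) xx∈ S∈
    ...   | _ , 0ᵗʰ , x∈ = x∉ x∈
    ...   | _ , 1ˢᵗ , x∈ = x∉ x∈

  opaque
    vertex-beside : ∀ {S a} → S ∈ F → a ∈ₛ S → ∃[ v ] v ∈ₛ S × v ≢ a
    vertex-beside {S} {a} S∈ a∈ with further-element (a∈ ∷ []) (λ eq →
      no-singleton a (subst (_∈ F) (trans eq (⟦⟧-cong (0ᵗʰ ∷ []) (0ᵗʰ ∷ 0ᵗʰ ∷ []))) S∈))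
    ... | v , v∈ , (v≢a ∷ []) = v , v∈ , v≢a

  Covers : Fin n → List (Subset n) → Set
  Covers x L = ∀ {S} → S ∈ F → x ∉ₛ S → S ∈ˡ L

  opaque
    -- Members of `F` through `x` belong to the star, the others to `L′`. The sizes are kept because
    -- the exceptional cases derive their bound on `F` from this form.
    exchange-sizes : ∀ x {L L′} → Unique L → (∀ {S} → S ∈ˡ L → (S ∈ H × x ∈ₛ S) × S ∉ F) →
      Covers x L′ → size F + length L ≤ size (star H x) + length L′
    exchange-sizes x {L} {L′} u L⊆ cov = size-exchange F (star H x) L L′ u L⊆ split
      where
      split : ∀ {S} → S ∈ F → S ∈ star H x ⊎ S ∈ˡ L′
      split {S} S∈ with x ∈ₛ? S
      ... | yes x∈ = inj₁ (F⊆H S∈ , x∈)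
      ... | no x∉ = inj₂ (cov S∈ x∉)

  opaque
    exchange : ∀ x {L L′} → Unique L → (∀ {S} → S ∈ˡ L → (S ∈ H × x ∈ₛ S) × S ∉ F) →
               Covers x L′ → length L ≤ length L′
    exchange x u L⊆ cov = +-cancelˡ-≤ (size F) _ _
      (≤-trans (exchange-sizes x u L⊆ cov) (+-monoˡ-≤ _ (large x)))

  -- The vertex v = x stands for the singleton {x}.
  Missing : Fin n → Fin n → Set
  Missing x v = π x v ∈ H × π x v ∉ F

  opaque
    pairs-missing : ∀ x {vs S} → All (Missing x) vs → S ∈ˡ map (π x) vs → (S ∈ H × x ∈ₛ S) × S ∉ F
    pairs-missing x miss S∈ with ∈-map⁻ _ S∈
    ... | v , v∈ , refl with All.lookup miss v∈
    ...   | inH , notF = (inH , ∈⟦⟧⁺ 0ᵗʰ) , notF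

  opaque
    exchange-pairs : ∀ x {vs L′} → Unique vs → All (Missing x) vs →
                     Covers x L′ → length vs ≤ length L′
    exchange-pairs x {vs} {L′} u miss cov =
      subst (_≤ length L′) (length-map (π x) vs)
        (exchange x {map (π x) vs} (Uniq.map⁺ (π-injective x) u) (pairs-missing x miss) cov)

  opaque
    -- Exchange used as a source of members: as soon as the missing sets at `x` outnumber the listed
    -- members, a new member avoiding `x` exists.
    uncovered : ∀ x {vs} L′ → Unique vs → All (Missing x) vs → length L′ < length vs →
                ∃[ S ] S ∈ F × x ∉ₛ S × All (S ≢_) L′
    uncovered x L′ u miss short
      with anySubset? (λ S → mem? F S ×-dec ¬? (x ∈ₛ? S) ×-dec fresh? S L′)
    ... | yes found = found
    ... | no none = ⊥-elim (<⇒≱ short (exchange-pairs x u miss λ S∈ x∉ →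
                      ¬fresh⇒∈ λ f → none (_ , S∈ , x∉ , f)))

  -- Two vertices that all members but at most one meet

  -- Members through only one of `x`, `y` have two further vertices, so the two sides are
  -- cross-intersecting graphs. In the second alternative of `slack` the missing pair `π x y` makes
  -- up for the one member `r` avoiding both.
  record Crossing (x y : Fin n) : Set where
    field
      x≠y   : x ≢ y
      no-x  : ∀ {v} → v ≢ y → π x v ∉ F
      no-y  : ∀ {v} → v ≢ x → π y v ∉ F
      slack : (∀ {S} → S ∈ F → x ∉ₛ S → y ∈ₛ S)
            ⊎ Missing x y × ∃[ r ] (∀ {S} → S ∈ F → x ∉ₛ S → y ∉ₛ S → S ≡ r)

  open Crossing

  opaque
    flip-crossing : ∀ {x y} → Crossing x y → Crossing y x
    flip-crossing {x} {y} cr = record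
      { x≠y = ≢-sym (x≠y cr) ; no-x = no-y cr ; no-y = no-x cr ; slack = flipped }
      where
      flipped : (∀ {S} → S ∈ F → y ∉ₛ S → x ∈ₛ S)
              ⊎ Missing y x × ∃[ r ] (∀ {S} → S ∈ F → y ∉ₛ S → x ∉ₛ S → S ≡ r)
      flipped with slack cr
      ... | inj₁ hit = inj₁ λ {S} S∈ y∉ → decidable-stable (x ∈ₛ? S) (y∉ ∘ hit S∈)
      ... | inj₂ (miss , r , unique) =
        inj₂ (subst (λ S → S ∈ H × S ∉ F) (π-swap x y) miss , r , λ S∈ y∉ x∉ → unique S∈ x∉ y∉)

  module _ {x y} (cr : Crossing x y) where

    Outer : Fin n → Set
    Outer v = v ≢ x × v ≢ y × π x v ∈ H

    opaque
      -- The additional one comes from the singleton of `x`, which is missing besides the pairs to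
      -- `vs`.
      exchange-crossing : ∀ {vs L′} → Unique vs → All Outer vs →
        (∀ {S} → S ∈ F → x ∉ₛ S → y ∈ₛ S → S ∈ˡ L′) → suc (length vs) ≤ length L′
      exchange-crossing {vs} {L′} u outer cov with slack cr
      ... | inj₁ hit = exchange-pairs x (All.map (≢-sym ∘ proj₁) outer ∷ u)
                         ((xx∈H , no-singleton x) ∷ missing) λ S∈ x∉ → cov S∈ x∉ (hit S∈ x∉)
        where
        xx∈H : π x x ∈ H
        xx∈H with avoid y
        ... | S , S∈ , y∉ = pair∈H S∈ x∈ x∈
          where
          x∈ : x ∈ₛ S
          x∈ = decidable-stable (x ∈ₛ? S) (y∉ ∘ hit S∈)
        missing : All (Missing x) vs
        missing = All.map (λ { (_ , v≢y , vH) → vH , no-x cr v≢y }) outer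
      -- Both `x` and `y` join `vs`, for the singleton and the missing pair, while only `r` joins
      -- `L′`: a gain of one remains.
      ... | inj₂ ((xyH , xy∉F) , r , only) = ≤-pred (exchange-pairs x {L′ = r ∷ L′}
          ((x≠y cr ∷ All.map (≢-sym ∘ proj₁) outer) ∷ All.map (≢-sym ∘ proj₁ ∘ proj₂) outer ∷ u)
          ((down xyH (⟦⟧-⊆ (∈⟦⟧⁺ 0ᵗʰ ∷ ∈⟦⟧⁺ 0ᵗʰ ∷ [])) , no-singleton x) ∷ (xyH , xy∉F) ∷ missing)
          cov′)
        where
        missing : All (Missing x) vs
        missing = All.map (λ { (_ , v≢y , vH) → vH , no-x cr v≢y }) outer
        cov′ : Covers x (r ∷ L′)
        cov′ {S} S∈ x∉ with y ∈ₛ? S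
        ... | yes y∈ = there (cov S∈ x∉ y∈)
        ... | no y∉ = here (only S∈ x∉ y∉)

    opaque
      uncovered-crossing : ∀ {vs} L′ → Unique vs → All Outer vs → length L′ ≤ length vs →
        ∃[ S ] S ∈ F × x ∉ₛ S × y ∈ₛ S × All (S ≢_) L′
      uncovered-crossing L′ u outer short
        with anySubset? (λ S → mem? F S ×-dec ¬? (x ∈ₛ? S) ×-dec y ∈ₛ? S ×-dec fresh? S L′)
      ... | yes found = found
      ... | no none = ⊥-elim (<⇒≱ (exchange-crossing u outer λ S∈ x∉ y∈ →
                        ¬fresh⇒∈ λ f → none (_ , S∈ , x∉ , y∈ , f)) short)

    opaque
      outer : ∀ {S v} → S ∈ F → x ∈ₛ S → y ∉ₛ S → v ∈ₛ S → v ≢ x → Outer v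
      outer S∈ x∈ y∉ v∈ v≢x = v≢x , (λ { refl → y∉ v∈ }) , pair∈H S∈ x∈ v∈

    opaque
      third : ∀ {S v} → S ∈ F → x ∈ₛ S → y ∉ₛ S → v ∈ₛ S →
              ∃[ w ] w ∈ₛ S × w ≢ x × w ≢ v
      third {S} {v} S∈ x∈ y∉ v∈ with further-element (x∈ ∷ v∈ ∷ [])
        (λ { refl → no-x cr (λ { refl → y∉ v∈ }) S∈ })
      ... | w , w∈ , (w≢x ∷ w≢v ∷ []) = w , w∈ , w≢x , w≢v

    opaque
      others : ∀ {S} → S ∈ F → x ∈ₛ S → y ∉ₛ S →
               ∃[ p ] ∃[ q ] p ∈ₛ S × q ∈ₛ S × p ≢ x × q ≢ x × p ≢ q
      others S∈ x∈ y∉ with vertex-beside S∈ x∈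
      ... | p , p∈ , p≢x with third S∈ x∈ y∉ p∈
      ...   | q , q∈ , q≢x , q≢p = p , q , p∈ , q∈ , p≢x , q≢x , ≢-sym q≢p

  -- For distinct `x`, `y`, `c`: the neighbours `w` of `c` in the graph of members through `x` that
  -- avoid `y`.
  Link : Fin n → Fin n → Fin n → Fin n → Set
  Link x y c w = τ x c w ∈ F × x ≢ w × y ≢ w × c ≢ w

  link? : ∀ x y c w → Dec (Link x y c w)
  link? x y c w = mem? F (τ x c w) ×-dec ¬? (x ≟ᶠ w) ×-dec ¬? (y ≟ᶠ w) ×-dec ¬? (c ≟ᶠ w)

  links : Fin n → Fin n → Fin n → List (Fin n)
  links x y c = filter (link? x y c) (allFin n)

  opaque
    links⁻ : ∀ x y c {w} → w ∈ˡ links x y c → Link x y c w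
    links⁻ x y c w∈ = proj₂ (∈-filter⁻ (link? x y c) {xs = allFin n} w∈)

  opaque
    links⁺ : ∀ {x y c w} → τ x c w ∈ F → x ≢ w → y ≢ w → c ≢ w → w ∈ˡ links x y c
    links⁺ {x} {y} {c} p q r s = ∈-filter⁺ (link? x y c) (∈-allFin _) (p , q , r , s)

  opaque
    links-unique : ∀ x y c → Unique (links x y c)
    links-unique x y c = Uniq.filter⁺ (link? x y c) (Uniq.allFin⁺ n)

  opaque
    links-pair∈H : ∀ x y c {w} → w ∈ˡ links x y c → π x w ∈ H
    links-pair∈H x y c w∈ = pair∈H (proj₁ (links⁻ x y c w∈)) (∈⟦⟧⁺ 0ᵗʰ) (∈⟦⟧⁺ 2ⁿᵈ)

  opaque
    link-member : ∀ {x y c S} → c ≢ y → S ∈ F → y ∈ₛ S → x ∉ₛ S → c ∈ₛ S → S ≢ π y c →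
                  S ∈ˡ map (τ y c) (links y x c)
    link-member {x} {y} {c} {S} c≢y S∈ y∈ x∉ c∈ S≢ with further-element (y∈ ∷ c∈ ∷ []) S≢
    ... | w , w∈ , (w≢y ∷ w≢c ∷ []) with triple S∈ (≢-sym c≢y) (≢-sym w≢y) (≢-sym w≢c) y∈ c∈ w∈
    ...   | refl = ∈-map⁺ (τ y c) (links⁺ S∈ (≢-sym w≢y) (λ { refl → x∉ w∈ }) (≢-sym w≢c))

  opaque
    -- With `c` as a centre, members through `y` only are counted by its links on that side. Against
    -- them stand its links on the side of `x`, the vertex `c` itself and the singleton of `x`. In
    -- both directions at once this is impossible.
    centre-count : ∀ {x y c} → Crossing x y → c ≢ x → c ≢ y → π x c ∈ H →
      (∀ {S} → S ∈ F → x ∉ₛ S → y ∈ₛ S → c ∈ₛ S) →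
      suc (suc (length (links x y c))) ≤ length (links y x c)
    centre-count {x} {y} {c} cr c≢x c≢y xcH centre = subst (suc (suc (length (links x y c))) ≤_) (length-map (τ y c) (links y x c))
      (exchange-crossing cr
        (All.tabulate (λ w∈ → proj₂ (proj₂ (proj₂ (links⁻ x y c w∈)))) ∷ links-unique x y c)
        ((c≢x , c≢y , xcH) ∷ All.tabulate λ w∈ → let _ , x≢w , y≢w , _ = links⁻ x y c w∈ in
          ≢-sym x≢w , ≢-sym y≢w , links-pair∈H x y c w∈)
        λ S∈ x∉ y∈ → link-member c≢y S∈ y∈ x∉ (centre S∈ x∉ y∈)
          λ { refl → no-y cr c≢x S∈ })

  opaque
    -- Exchange at `x` yields a member through `y` only, and one outer vertex of `x` suffices for a
    -- second. Two distinct triples through `y` have at least three further vertices between them.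
    three-outers : ∀ {x y} (cr : Crossing x y) →
      ∃[ p ] ∃[ q ] ∃[ r ] Unique (p ∷ q ∷ r ∷ []) × All (Outer (flip-crossing cr)) (p ∷ q ∷ r ∷ [])
    three-outers {x} {y} cr
      with uncovered-crossing cr {[]} [] [] [] z≤n
         | uncovered-crossing (flip-crossing cr) {[]} [] [] [] z≤n
    ... | T₀ , T₀∈ , x∉T₀ , y∈T₀ , _ | S₀ , S₀∈ , y∉S₀ , x∈S₀ , _
      with others cr S₀∈ x∈S₀ y∉S₀ | others (flip-crossing cr) T₀∈ y∈T₀ x∉T₀
    ... | p , _ , p∈S₀ , _ , p≢x , _ | r , s , r∈T₀ , s∈T₀ , r≢y , s≢y , r≢s
      with uncovered-crossing cr (T₀ ∷ []) ([] ∷ []) (outer cr S₀∈ x∈S₀ y∉S₀ p∈S₀ p≢x ∷ []) (s≤s z≤n)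
    ... | T₁ , T₁∈ , x∉T₁ , y∈T₁ , (T₁≢T₀ ∷ [])
      with anyFin? (λ t → t ∈ₛ? T₁ ×-dec ¬? (t ∈ₛ? T₀))
    ... | yes (t , t∈T₁ , t∉T₀) = t , r , s
        , (t∉T₀ ∉⇒All (r∈T₀ ∷ s∈T₀ ∷ [])) ∷ (r≢s ∷ []) ∷ [] ∷ []
        , outer′ T₁∈ y∈T₁ x∉T₁ t∈T₁ (λ { refl → t∉T₀ y∈T₀ })
          ∷ outer′ T₀∈ y∈T₀ x∉T₀ r∈T₀ r≢y ∷ outer′ T₀∈ y∈T₀ x∉T₀ s∈T₀ s≢y ∷ []
      where
      outer′ : ∀ {S v} → S ∈ F → y ∈ₛ S → x ∉ₛ S → v ∈ₛ S → v ≢ y → Outer (flip-crossing cr) v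
      outer′ = outer (flip-crossing cr)
    ... | no ⊆ with others (flip-crossing cr) T₁∈ y∈T₁ x∉T₁
    ...   | a , b , a∈ , b∈ , a≢y , b≢y , a≢b =
      ⊥-elim (T₁≢T₀ (trans (triple T₁∈ (≢-sym a≢y) (≢-sym b≢y) a≢b y∈T₁ a∈ b∈)
                      (sym (triple T₀∈ (≢-sym a≢y) (≢-sym b≢y) a≢b y∈T₀ (in₀ a∈) (in₀ b∈)))))
      where
      in₀ : ∀ {v} → v ∈ₛ T₁ → v ∈ₛ T₀
      in₀ {v} v∈ = decidable-stable (v ∈ₛ? T₀) λ v∉ → ⊆ (v , v∈ , v∉)

  opaque
    -- Three outer vertices of `y` force a member through `x` only, other than the triples of `x`
    -- with two of `p`, `q`, `v`; it has a vertex beyond these four.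
    four-outers : ∀ {x y} (cr : Crossing x y) →
      ∃[ vs ] Unique vs × All (Outer cr) vs × 4 ≤ length vs
    four-outers {x} {y} cr
      with three-outers (flip-crossing cr) | three-outers cr
    ... | p , q , v , ((p≢q ∷ p≢v ∷ _) ∷ (q≢v ∷ _) ∷ _)
        , (op@(p≢x , p≢y , _) ∷ oq@(q≢x , q≢y , _) ∷ ov@(v≢x , v≢y , _) ∷ _)
        | _ , _ , _ , us-unique , us-outer
      with uncovered-crossing (flip-crossing cr) (τ x p q ∷ τ x p v ∷ τ x q v ∷ [])
             us-unique us-outer ≤-refl
    ... | S , S∈ , y∉ , x∈ , (≢xpq ∷ ≢xpv ∷ ≢xqv ∷ []) with fourth
      where
      not-both : ∀ {a b} → S ≢ τ x a b → a ≢ x → b ≢ x → a ≢ b → a ∈ₛ S → b ∉ₛ S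
      not-both S≢ a≢x b≢x a≢b a∈ b∈ = S≢ (triple S∈ (≢-sym a≢x) (≢-sym b≢x) a≢b x∈ a∈ b∈)
      fourth : ∃[ w ] w ∈ₛ S × All (w ≢_) (x ∷ p ∷ q ∷ v ∷ [])
      fourth with p ∈ₛ? S | q ∈ₛ? S | v ∈ₛ? S
      ... | yes p∈ | _ | _ with third cr S∈ x∈ y∉ p∈
      ...   | w , w∈ , w≢x , w≢p = w , w∈ , w≢x ∷ w≢p
              ∷ (λ { refl → not-both ≢xpq p≢x q≢x p≢q p∈ w∈ })
              ∷ (λ { refl → not-both ≢xpv p≢x v≢x p≢v p∈ w∈ }) ∷ []
      fourth | no p∉ | yes q∈ | _ with third cr S∈ x∈ y∉ q∈
      ...   | w , w∈ , w≢x , w≢q = w , w∈ , w≢x ∷ (λ { refl → p∉ w∈ }) ∷ w≢q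
              ∷ (λ { refl → not-both ≢xqv q≢x v≢x q≢v q∈ w∈ }) ∷ []
      fourth | no p∉ | no q∉ | yes v∈ with third cr S∈ x∈ y∉ v∈
      ...   | w , w∈ , w≢x , w≢v = w , w∈
              , w≢x ∷ (λ { refl → p∉ w∈ }) ∷ (λ { refl → q∉ w∈ }) ∷ w≢v ∷ []
      fourth | no p∉ | no q∉ | no v∉ with vertex-beside S∈ x∈
      ...   | w , w∈ , w≢x = w , w∈
              , w≢x ∷ (λ { refl → p∉ w∈ }) ∷ (λ { refl → q∉ w∈ }) ∷ (λ { refl → v∉ w∈ }) ∷ []
    ... | w , w∈ , (w≢x ∷ w≢pqv) = w ∷ p ∷ q ∷ v ∷ []
        , w≢pqv ∷ (p≢q ∷ p≢v ∷ []) ∷ (q≢v ∷ []) ∷ [] ∷ []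
        , outer cr S∈ x∈ y∉ w∈ w≢x ∷ op ∷ oq ∷ ov ∷ []
        , ≤-refl

  -- Otherwise every set on the other side would pick one of two vertices in
  -- each of two disjoint pairs: at most four sets, against four outer vertices.
  opaque
    share : ∀ {x y} → Crossing x y → ∀ {S S′} → S ∈ F → x ∈ₛ S → y ∉ₛ S →
            S′ ∈ F → x ∈ₛ S′ → y ∉ₛ S′ → ∃[ c ] c ∈ₛ S × c ∈ₛ S′ × c ≢ x
    share {x} {y} cr {S} {S′} S∈ x∈S y∉S S′∈ x∈S′ y∉S′
      with anyFin? (λ c → c ∈ₛ? S ×-dec c ∈ₛ? S′ ×-dec ¬? (c ≟ᶠ x))
    ... | yes found = found
    ... | no disjoint
      with others cr S∈ x∈S y∉S | others cr S′∈ x∈S′ y∉S′ | four-outers cr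
    ... | p , q , p∈ , q∈ , p≢x , q≢x , p≢q | r , s , r∈ , s∈ , r≢x , s≢x , r≢s | vs , u , o , 4≤
      with triple S∈ (≢-sym p≢x) (≢-sym q≢x) p≢q x∈S p∈ q∈
         | triple S′∈ (≢-sym r≢x) (≢-sym s≢x) r≢s x∈S′ r∈ s∈
         | uncovered-crossing cr (τ y p r ∷ τ y p s ∷ τ y q r ∷ τ y q s ∷ []) u o 4≤
    ... | refl | refl | T , T∈ , x∉T , y∈T , (≢ypr ∷ ≢yps ∷ ≢yqr ∷ ≢yqs ∷ [])
      with meets-list (x ∷ p ∷ q ∷ []) S∈ T∈ | meets-list (x ∷ r ∷ s ∷ []) S′∈ T∈
    ... | _ , 0ᵗʰ , x∈T | _ = ⊥-elim (x∉T x∈T)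
    ... | _ , 1ˢᵗ , _ | _ , 0ᵗʰ , x∈T = ⊥-elim (x∉T x∈T)
    ... | _ , 2ⁿᵈ , _ | _ , 0ᵗʰ , x∈T = ⊥-elim (x∉T x∈T)
    ... | _ , 1ˢᵗ , p∈T | _ , 1ˢᵗ , r∈T = ⊥-elim (≢ypr (triple T∈ (λ { refl → y∉S p∈ })
            (λ { refl → y∉S′ r∈ }) (λ { refl → disjoint (_ , p∈ , r∈ , p≢x) }) y∈T p∈T r∈T))
    ... | _ , 1ˢᵗ , p∈T | _ , 2ⁿᵈ , s∈T = ⊥-elim (≢yps (triple T∈ (λ { refl → y∉S p∈ })
            (λ { refl → y∉S′ s∈ }) (λ { refl → disjoint (_ , p∈ , s∈ , p≢x) }) y∈T p∈T s∈T))
    ... | _ , 2ⁿᵈ , q∈T | _ , 1ˢᵗ , r∈T = ⊥-elim (≢yqr (triple T∈ (λ { refl → y∉S q∈ })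
            (λ { refl → y∉S′ r∈ }) (λ { refl → disjoint (_ , q∈ , r∈ , q≢x) }) y∈T q∈T r∈T))
    ... | _ , 2ⁿᵈ , q∈T | _ , 2ⁿᵈ , s∈T = ⊥-elim (≢yqs (triple T∈ (λ { refl → y∉S q∈ })
            (λ { refl → y∉S′ s∈ }) (λ { refl → disjoint (_ , q∈ , s∈ , q≢x) }) y∈T q∈T s∈T))

  opaque
    -- By `share`, edges on one side meet pairwise. Three of them that form no triangle have a
    -- common vertex `c`, and a member on either side that omits `c` would need four elements. Then
    -- `centre-count` applies in both directions.
    no-crossing : ∀ {x y} → Crossing x y → Absurd
    no-crossing {x} {y} cr
      with three-outers cr
    ... | _ , _ , _ , us-unique , us-outer
      with uncovered-crossing (flip-crossing cr) [] us-unique us-outer z≤n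
    ... | S₀ , S₀∈ , y∉S₀ , x∈S₀ , _
      with uncovered-crossing (flip-crossing cr) (S₀ ∷ []) us-unique us-outer (s≤s z≤n)
    ... | S₁ , S₁∈ , y∉S₁ , x∈S₁ , (S₁≢S₀ ∷ [])
      with share cr S₀∈ x∈S₀ y∉S₀ S₁∈ x∈S₁ y∉S₁
    ... | c , c∈S₀ , c∈S₁ , c≢x
      with third cr S₀∈ x∈S₀ y∉S₀ c∈S₀ | third cr S₁∈ x∈S₁ y∉S₁ c∈S₁
    ... | q , q∈S₀ , q≢x , q≢c | t , t∈S₁ , t≢x , t≢c
      with triple S₀∈ (≢-sym c≢x) (≢-sym q≢x) (≢-sym q≢c) x∈S₀ c∈S₀ q∈S₀
         | triple S₁∈ (≢-sym c≢x) (≢-sym t≢x) (≢-sym t≢c) x∈S₁ c∈S₁ t∈S₁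
         -- `τ x q t` is listed as well, since it would close a triangle instead of giving a third
         -- edge at `c`.
         | uncovered-crossing (flip-crossing cr) (τ x c q ∷ τ x c t ∷ τ x q t ∷ [])
             us-unique us-outer ≤-refl
    ... | refl | refl | S₂ , S₂∈ , y∉S₂ , x∈S₂ , (≢xcq ∷ ≢xct ∷ ≢xqt ∷ []) = clash
      where
      q≢t : q ≢ t
      q≢t refl = S₁≢S₀ refl

      shared : ∀ {a b S} → τ x a b ∈ F → y ∉ₛ τ x a b → S ∈ F → x ∈ₛ S → y ∉ₛ S →
               a ∈ₛ S ⊎ b ∈ₛ S
      shared {a} {b} R∈ y∉R S∈ x∈ y∉ with share cr R∈ (∈⟦⟧⁺ 0ᵗʰ) y∉R S∈ x∈ y∉
      ... | v , v∈ , v∈S , v≢x with ∈⟦⟧⁻ (x ∷ a ∷ b ∷ []) v∈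
      ...   | 0ᵗʰ = ⊥-elim (v≢x refl)
      ...   | 1ˢᵗ = inj₁ v∈S
      ...   | 2ⁿᵈ = inj₂ v∈S

      c∈S₂ : c ∈ₛ S₂
      c∈S₂ with shared S₀∈ y∉S₀ S₂∈ x∈S₂ y∉S₂ | shared S₁∈ y∉S₁ S₂∈ x∈S₂ y∉S₂
      ... | inj₁ c∈ | _ = c∈
      ... | inj₂ _ | inj₁ c∈ = c∈
      ... | inj₂ q∈ | inj₂ t∈ =
        ⊥-elim (≢xqt (triple S₂∈ (≢-sym q≢x) (≢-sym t≢x) q≢t x∈S₂ q∈ t∈))

      S₂-third : ∃[ v ] v ∈ₛ S₂ × v ≢ x × v ≢ c
      S₂-third = third cr S₂∈ x∈S₂ y∉S₂ c∈S₂
      v : Fin n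
      v = proj₁ S₂-third
      v∈S₂ : v ∈ₛ S₂
      v∈S₂ = proj₁ (proj₂ S₂-third)
      v≢x : v ≢ x
      v≢x = proj₁ (proj₂ (proj₂ S₂-third))
      v≢c : v ≢ c
      v≢c = proj₂ (proj₂ (proj₂ S₂-third))

      S₂≡ : S₂ ≡ τ x c v
      S₂≡ = triple S₂∈ (≢-sym c≢x) (≢-sym v≢x) (≢-sym v≢c) x∈S₂ c∈S₂ v∈S₂

      xcv∈ : τ x c v ∈ F
      xcv∈ = subst (_∈ F) S₂≡ S₂∈
      y∉xcv : y ∉ₛ τ x c v
      y∉xcv = subst (y ∉ₛ_) S₂≡ y∉S₂

      v≢q : v ≢ q
      v≢q eq = ≢xcq (trans S₂≡ (cong (τ x c) eq))
      v≢t : v ≢ t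
      v≢t eq = ≢xct (trans S₂≡ (cong (τ x c) eq))

      x-centre : ∀ {S} → S ∈ F → y ∉ₛ S → x ∈ₛ S → c ∈ₛ S
      x-centre S∈ y∉ x∈
        with shared S₀∈ y∉S₀ S∈ x∈ y∉ | shared S₁∈ y∉S₁ S∈ x∈ y∉ | shared xcv∈ y∉xcv S∈ x∈ y∉
      ... | inj₁ c∈ | _ | _ = c∈
      ... | _ | inj₁ c∈ | _ = c∈
      ... | _ | _ | inj₁ c∈ = c∈
      ... | inj₂ q∈ | inj₂ t∈ | inj₂ v∈ = ⊥-elim (no-four S∈
            ((≢-sym q≢x ∷ ≢-sym t≢x ∷ ≢-sym v≢x ∷ []) ∷ (q≢t ∷ ≢-sym v≢q ∷ []) ∷ (≢-sym v≢t ∷ []) ∷ [] ∷ [])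
            (x∈ ∷ q∈ ∷ t∈ ∷ v∈ ∷ []))

      hit : ∀ {a b T} → τ x a b ∈ F → T ∈ F → x ∉ₛ T → a ∈ₛ T ⊎ b ∈ₛ T
      hit {a} {b} S∈ T∈ x∉ with meets-list (x ∷ a ∷ b ∷ []) S∈ T∈
      ... | _ , 0ᵗʰ , x∈ = ⊥-elim (x∉ x∈)
      ... | _ , 1ˢᵗ , a∈ = inj₁ a∈
      ... | _ , 2ⁿᵈ , b∈ = inj₂ b∈

      y-centre : ∀ {T} → T ∈ F → x ∉ₛ T → y ∈ₛ T → c ∈ₛ T
      y-centre T∈ x∉ y∈ with hit S₀∈ T∈ x∉ | hit S₁∈ T∈ x∉ | hit xcv∈ T∈ x∉
      ... | inj₁ c∈ | _ | _ = c∈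
      ... | _ | inj₁ c∈ | _ = c∈
      ... | _ | _ | inj₁ c∈ = c∈
      ... | inj₂ q∈ | inj₂ t∈ | inj₂ v∈ = ⊥-elim (no-four T∈
            (((λ { refl → y∉S₀ q∈S₀ }) ∷ (λ { refl → y∉S₁ t∈S₁ }) ∷ (λ eq → y∉S₂ (subst (_∈ₛ S₂) (sym eq) v∈S₂)) ∷ [])
              ∷ (q≢t ∷ ≢-sym v≢q ∷ []) ∷ (≢-sym v≢t ∷ []) ∷ [] ∷ [])
            (y∈ ∷ q∈ ∷ t∈ ∷ v∈ ∷ []))

      c≢y : c ≢ y
      c≢y refl = y∉S₀ c∈S₀

      yc∈H : π y c ∈ H
      yc∈H with uncovered-crossing cr {[]} [] [] [] z≤n
      ... | T , T∈ , x∉ , y∈ , _ = pair∈H T∈ y∈ (y-centre T∈ x∉ y∈)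

      clash : Absurd
      clash = <⇒≱ (≤-trans (n≤1+n _) (centre-count cr c≢x c≢y (pair∈H S₀∈ x∈S₀ c∈S₀) y-centre))
                   (≤-trans (≤-trans (n≤1+n _) (n≤1+n _)) (centre-count (flip-crossing cr) c≢y c≢x yc∈H x-centre))

  -- 3-uniform families

  module Uniform (no-pair : ∀ a b → π a b ∉ F) where

    opaque
      third-vertex : ∀ {S a b} → S ∈ F → a ∈ₛ S → b ∈ₛ S → ∃[ w ] w ∈ₛ S × w ≢ a × w ≢ b
      third-vertex {S} {a} {b} S∈ a∈ b∈
        with further-element (a∈ ∷ b∈ ∷ []) (λ eq → no-pair a b (subst (_∈ F) eq S∈))
      ... | w , w∈ , (w≢a ∷ w≢b ∷ []) = w , w∈ , w≢a , w≢b

    opaque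
      meets-third : ∀ {x y z S} → τ x y z ∈ F → S ∈ F → x ∉ₛ S → y ∉ₛ S → z ∈ₛ S
      meets-third {x} {y} {z} T∈ S∈ x∉ y∉ with meets-list (x ∷ y ∷ z ∷ []) T∈ S∈
      ... | _ , 0ᵗʰ , x∈ = ⊥-elim (x∉ x∈)
      ... | _ , 1ˢᵗ , y∈ = ⊥-elim (y∉ y∈)
      ... | _ , 2ⁿᵈ , z∈ = z∈

    record Through (x y : Fin n) (S : Subset n) : Set where
      constructor through
      field
        mem   : S ∈ F
        left  : x ∈ₛ S
        right : y ∈ₛ S

    open Through

    through? : ∀ x y S → Dec (Through x y S)
    through? x y S = map′ (λ (a , b , c) → through a b c) (λ (through a b c) → a , b , c)
                          (mem? F S ×-dec x ∈ₛ? S ×-dec y ∈ₛ? S)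

    opaque
      -- A member avoiding `x` and `y` contains the third vertices of all three sets and hence
      -- equals that triple, so `x` and `y` form a `Crossing`.
      codegree-≤2 : ∀ {x y S₁ S₂ S₃} → x ≢ y → Through x y S₁ → Through x y S₂ → Through x y S₃ →
                    S₁ ≢ S₂ → S₁ ≢ S₃ → S₂ ≢ S₃ → Absurd
      codegree-≤2 {x} {y} x≢y (through S₁∈ x₁ y₁) (through S₂∈ x₂ y₂) (through S₃∈ x₃ y₃) S₁≢S₂ S₁≢S₃ S₂≢S₃
        with third-vertex S₁∈ x₁ y₁ | third-vertex S₂∈ x₂ y₂ | third-vertex S₃∈ x₃ y₃
      ... | z₁ , z₁∈ , z₁≢x , z₁≢y | z₂ , z₂∈ , z₂≢x , z₂≢y | z₃ , z₃∈ , z₃≢x , z₃≢y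
        with triple S₁∈ x≢y (≢-sym z₁≢x) (≢-sym z₁≢y) x₁ y₁ z₁∈
           | triple S₂∈ x≢y (≢-sym z₂≢x) (≢-sym z₂≢y) x₂ y₂ z₂∈
           | triple S₃∈ x≢y (≢-sym z₃≢x) (≢-sym z₃≢y) x₃ y₃ z₃∈
      ... | refl | refl | refl = no-crossing record
        { x≠y = x≢y ; no-x = λ _ → no-pair _ _ ; no-y = λ _ → no-pair _ _
        ; slack = inj₂ ((pair∈H S₁∈ x₁ y₁ , no-pair x y) , τ z₁ z₂ z₃ , λ S∈ x∉ y∉ →
            triple S∈ (λ { refl → S₁≢S₂ refl }) (λ { refl → S₁≢S₃ refl }) (λ { refl → S₂≢S₃ refl })
              (meets-third S₁∈ S∈ x∉ y∉) (meets-third S₂∈ S∈ x∉ y∉) (meets-third S₃∈ S∈ x∉ y∉)) }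

    opaque
      at-most-one-more : ∀ {x y S} → x ≢ y → Through x y S →
        ∃[ L ] length L ≤ 1 × (∀ {T} → Through x y T → T ≢ S → T ∈ˡ L)
      at-most-one-more {x} {y} {S} x≢y thS with anySubset? (λ T → through? x y T ×-dec ¬? (T ≟ˢ S))
      ... | no none = [] , z≤n , λ thT T≢S → ⊥-elim (none (_ , thT , T≢S))
      ... | yes (T , thT , T≢S) = T ∷ [] , ≤-refl , λ {U} thU U≢S → here (decidable-stable (U ≟ˢ T)
              λ U≢T → codegree-≤2 x≢y thS thT thU (≢-sym T≢S) (≢-sym U≢S) (≢-sym U≢T))

    -- What arises when two members pass through `x` and `y` and two avoid both: the latter must
    -- contain `z₁` and `z₂`.
    record Fork (x y z₁ z₂ w₁ w₂ : Fin n) : Set where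
      field
        distinct : Unique (x ∷ y ∷ z₁ ∷ z₂ ∷ w₁ ∷ w₂ ∷ [])
        xyz₁ : τ x y z₁ ∈ F
        xyz₂ : τ x y z₂ ∈ F
        zzw₁ : τ z₁ z₂ w₁ ∈ F
        zzw₂ : τ z₁ z₂ w₂ ∈ F

    open Fork

    flip-fork : ∀ {x y z₁ z₂ w₁ w₂} → Fork x y z₁ z₂ w₁ w₂ → Fork y x z₁ z₂ w₁ w₂
    flip-fork {x} {y} f with distinct f
    ... | (x≢y ∷ x≢s) ∷ y≢s ∷ u = record
      { distinct = (≢-sym x≢y ∷ y≢s) ∷ x≢s ∷ u
      ; xyz₁ = subst (_∈ F) swap (xyz₁ f) ; xyz₂ = subst (_∈ F) swap (xyz₂ f)
      ; zzw₁ = zzw₁ f ; zzw₂ = zzw₂ f }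
      where
      swap : ∀ {z} → τ x y z ≡ τ y x z
      swap = ⟦⟧-cong (1ˢᵗ ∷ 0ᵗʰ ∷ 2ⁿᵈ ∷ []) (1ˢᵗ ∷ 0ᵗʰ ∷ 2ⁿᵈ ∷ [])

    module _ {x y z₁ z₂ w₁ w₂} (f : Fork x y z₁ z₂ w₁ w₂) where

      opaque
        through-zz : ∀ {S} → Through z₁ z₂ S → S ≡ τ z₁ z₂ w₁ ⊎ S ≡ τ z₁ z₂ w₂
        through-zz {S} th with distinct f | S ≟ˢ τ z₁ z₂ w₁ | S ≟ˢ τ z₁ z₂ w₂
        ... | _ | yes eq | _ = inj₁ eq
        ... | _ | _ | yes eq = inj₂ eq
        ... | _ ∷ _ ∷ (z₁≢z₂ ∷ z₁≢w₁ ∷ _) ∷ (z₂≢w₁ ∷ _) ∷ (w₁≢w₂ ∷ []) ∷ _ | no ≢₁ | no ≢₂ =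
          ⊥-elim (codegree-≤2 z₁≢z₂ (through (zzw₁ f) (∈⟦⟧⁺ 0ᵗʰ) (∈⟦⟧⁺ 1ˢᵗ))
            (through (zzw₂ f) (∈⟦⟧⁺ 0ᵗʰ) (∈⟦⟧⁺ 1ˢᵗ)) th
            (λ eq → w₁≢w₂ (τ-cancel eq (≢-sym z₁≢w₁) (≢-sym z₂≢w₁))) (≢-sym ≢₁) (≢-sym ≢₂))

      opaque
        -- Avoiding `x` and `y` means containing `z₁` and `z₂`: two sets. With `y` and one of `z₁`,
        -- `z₂` there is at most one further set each: two more. With `y` and neither, both `w₁` and
        -- `w₂` are needed.
        fork-cover : ∃[ L ] length L ≤ 4 ×
          (∀ {S} → S ∈ F → x ∉ₛ S → S ∈ˡ L ⊎ (y ∈ₛ S × w₁ ∈ₛ S × w₂ ∈ₛ S))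
        fork-cover with distinct f
        ... | (x≢y ∷ _) ∷ (y≢z₁ ∷ y≢z₂ ∷ _) ∷ _
          with at-most-one-more y≢z₁ (through (xyz₁ f) (∈⟦⟧⁺ 1ˢᵗ) (∈⟦⟧⁺ 2ⁿᵈ))
             | at-most-one-more y≢z₂ (through (xyz₂ f) (∈⟦⟧⁺ 1ˢᵗ) (∈⟦⟧⁺ 2ⁿᵈ))
        ... | L₁ , L₁≤ , in₁ | L₂ , L₂≤ , in₂ =
          τ z₁ z₂ w₁ ∷ τ z₁ z₂ w₂ ∷ L₁ ++ L₂ ,
          s≤s (s≤s (≤-trans (≤-reflexive (length-++ L₁)) (+-mono-≤ L₁≤ L₂≤))) , cover
          where
          cover : ∀ {S} → S ∈ F → x ∉ₛ S →
                  S ∈ˡ τ z₁ z₂ w₁ ∷ τ z₁ z₂ w₂ ∷ L₁ ++ L₂ ⊎ (y ∈ₛ S × w₁ ∈ₛ S × w₂ ∈ₛ S)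
          cover {S} S∈ x∉ with y ∈ₛ? S | z₁ ∈ₛ? S | z₂ ∈ₛ? S
          ... | no y∉ | _ | _ = inj₁ (Sum.[ here , there ∘ here ]′ (through-zz (through S∈
                  (meets-third (xyz₁ f) S∈ x∉ y∉) (meets-third (xyz₂ f) S∈ x∉ y∉))))
          ... | yes y∈ | yes z∈ | _ = inj₁ (there (there (∈-++⁺ˡ (in₁ (through S∈ y∈ z∈)
                  λ { refl → x∉ (∈⟦⟧⁺ 0ᵗʰ) }))))
          ... | yes y∈ | no _ | yes z∈ = inj₁ (there (there (∈-++⁺ʳ L₁ (in₂ (through S∈ y∈ z∈)
                  λ { refl → x∉ (∈⟦⟧⁺ 0ᵗʰ) }))))
          ... | yes y∈ | no z₁∉ | no z₂∉ = inj₂ (y∈ , meets-third (zzw₁ f) S∈ z₁∉ z₂∉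
                                                   , meets-third (zzw₂ f) S∈ z₁∉ z₂∉)

      missing-basic : All (Missing x) (x ∷ y ∷ z₁ ∷ z₂ ∷ [])
      missing-basic = at (xyz₁ f) 0ᵗʰ ∷ at (xyz₁ f) 1ˢᵗ ∷ at (xyz₁ f) 2ⁿᵈ ∷ at (xyz₂ f) 2ⁿᵈ ∷ []
        where
        at : ∀ {l v} → ⟦ x ∷ l ⟧ ∈ F → v ∈ˡ x ∷ l → Missing x v
        at S∈ v∈ = pair∈H S∈ (∈⟦⟧⁺ 0ᵗʰ) (∈⟦⟧⁺ v∈) , no-pair _ _

    opaque
      -- Exchange at `y` sets four missing sets against the two members through `z₁` and `z₂`. The
      -- new member avoiding `y` passes through `x` but not through both `z₁` and `z₂`, and so
      -- supplies `v`.
      fork-fifth : ∀ {x y z₁ z₂ w₁ w₂} → Fork x y z₁ z₂ w₁ w₂ →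
        ∃[ v ] All (v ≢_) (x ∷ y ∷ z₁ ∷ z₂ ∷ []) × Missing x v
      fork-fifth {x} {y} {z₁} {z₂} {w₁} {w₂} f with distinct f | distinct (flip-fork f)
      ... | (x≢y ∷ x≢z₁ ∷ x≢z₂ ∷ _) ∷ (y≢z₁ ∷ y≢z₂ ∷ _) ∷ (z₁≢z₂ ∷ _) ∷ _ | uf
        with uncovered y (τ z₁ z₂ w₁ ∷ τ z₁ z₂ w₂ ∷ [])
          ((≢-sym x≢y ∷ y≢z₁ ∷ y≢z₂ ∷ []) ∷ (x≢z₁ ∷ x≢z₂ ∷ []) ∷ (z₁≢z₂ ∷ []) ∷ [] ∷ [])
          (missing-basic (flip-fork f)) (s≤s (s≤s (s≤s z≤n)))
      ... | S , S∈ , y∉ , (≢₁ ∷ ≢₂ ∷ []) = result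
        where
        not-zz : z₁ ∈ₛ S → z₂ ∈ₛ S → Absurd
        not-zz z₁∈ z₂∈ = [ ≢₁ , ≢₂ ]′ (through-zz f (through S∈ z₁∈ z₂∈))
        x∈ : x ∈ₛ S
        x∈ = decidable-stable (x ∈ₛ? S) λ x∉ →
          not-zz (meets-third (xyz₁ f) S∈ x∉ y∉) (meets-third (xyz₂ f) S∈ x∉ y∉)
        result : ∃[ v ] All (v ≢_) (x ∷ y ∷ z₁ ∷ z₂ ∷ []) × Missing x v
        result with z₁ ∈ₛ? S
        ... | yes z₁∈ with third-vertex S∈ x∈ z₁∈
        ...   | v , v∈ , v≢x , v≢z₁ = v , v≢x ∷ (λ { refl → y∉ v∈ }) ∷ v≢z₁ ∷ (λ { refl → not-zz z₁∈ v∈ }) ∷ []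
                                      , pair∈H S∈ x∈ v∈ , no-pair x v
        result | no z₁∉ with z₂ ∈ₛ? S
        ... | yes z₂∈ with third-vertex S∈ x∈ z₂∈
        ...   | v , v∈ , v≢x , v≢z₂ = v , v≢x ∷ (λ { refl → y∉ v∈ }) ∷ (λ { refl → z₁∉ v∈ }) ∷ v≢z₂ ∷ []
                                      , pair∈H S∈ x∈ v∈ , no-pair x v
        result | no z₁∉ | no z₂∉ with vertex-beside S∈ x∈
        ...   | v , v∈ , v≢x = v , v≢x ∷ (λ { refl → y∉ v∈ }) ∷ (λ { refl → z₁∉ v∈ }) ∷ (λ { refl → z₂∉ v∈ }) ∷ []
                                      , pair∈H S∈ x∈ v∈ , no-pair x v

    opaque
      -- Five missing sets at `x` exceed the list of `fork-cover`, so its other alternative must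
      -- occur.
      fork-transversal : ∀ {x y z₁ z₂ w₁ w₂} → Fork x y z₁ z₂ w₁ w₂ →
        ∃[ T ] T ∈ F × y ∈ₛ T × w₁ ∈ₛ T × w₂ ∈ₛ T
      fork-transversal {x} f with distinct f | fork-fifth f | fork-cover f
      ... | (x≢y ∷ x≢z₁ ∷ x≢z₂ ∷ _) ∷ (y≢z₁ ∷ y≢z₂ ∷ _) ∷ (z₁≢z₂ ∷ _) ∷ _ | v , v≢ , vM | L , L≤ , cover
        with uncovered x L (v≢ ∷ (x≢y ∷ x≢z₁ ∷ x≢z₂ ∷ []) ∷ (y≢z₁ ∷ y≢z₂ ∷ []) ∷ (z₁≢z₂ ∷ []) ∷ [] ∷ [])
               (vM ∷ missing-basic f) (s≤s L≤)
      ... | T , T∈ , x∉ , T∉L with cover T∈ x∉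
      ...   | inj₁ T∈L = ⊥-elim (All.lookup T∉L T∈L refl)
      ...   | inj₂ (y∈ , w₁∈ , w₂∈) = T , T∈ , y∈ , w₁∈ , w₂∈

    opaque
      -- The transversal through `x`, `w₁`, `w₂` makes two more pairs missing at `x`: six sets
      -- against the at most five in `τ y w₁ w₂ ∷ L`.
      no-fork : ∀ {x y z₁ z₂ w₁ w₂} → Fork x y z₁ z₂ w₁ w₂ → Absurd
      no-fork {x} {y} {z₁} {z₂} {w₁} {w₂} f with fork-transversal (flip-fork f) | fork-cover f
      ... | T , T∈ , x∈ , w₁∈ , w₂∈ | L , L≤ , cover with distinct f
      ... | (x≢y ∷ x≢z₁ ∷ x≢z₂ ∷ x≢w₁ ∷ x≢w₂ ∷ []) ∷ (y≢z₁ ∷ y≢z₂ ∷ y≢w₁ ∷ y≢w₂ ∷ []) ∷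
            (z₁≢z₂ ∷ z₁≢w₁ ∷ z₁≢w₂ ∷ []) ∷ (z₂≢w₁ ∷ z₂≢w₂ ∷ []) ∷ (w₁≢w₂ ∷ []) ∷ _
        with uncovered x (τ y w₁ w₂ ∷ L)
          ((≢-sym x≢w₁ ∷ ≢-sym y≢w₁ ∷ ≢-sym z₁≢w₁ ∷ ≢-sym z₂≢w₁ ∷ w₁≢w₂ ∷ []) ∷
           (x≢y ∷ x≢z₁ ∷ x≢z₂ ∷ x≢w₂ ∷ []) ∷ (y≢z₁ ∷ y≢z₂ ∷ y≢w₂ ∷ []) ∷ (z₁≢z₂ ∷ z₁≢w₂ ∷ []) ∷ (z₂≢w₂ ∷ []) ∷ [] ∷ [])
          ((pair∈H T∈ x∈ w₁∈ , no-pair x w₁) ∷ append (pair∈H T∈ x∈ w₂∈ , no-pair x w₂) (missing-basic f))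
          (s≤s (s≤s L≤))
        where
        append : ∀ {a b c d e} → Missing x e → All (Missing x) (a ∷ b ∷ c ∷ d ∷ []) → All (Missing x) (a ∷ b ∷ c ∷ d ∷ e ∷ [])
        append e (a ∷ b ∷ c ∷ d ∷ []) = a ∷ b ∷ c ∷ d ∷ e ∷ []
      ... | U , U∈ , x∉ , (≢yww ∷ U∉L) with cover U∈ x∉
      ...   | inj₁ U∈L = All.lookup U∉L U∈L refl
      ...   | inj₂ (y∈ , w₁∈U , w₂∈U) = ≢yww (triple U∈ y≢w₁ y≢w₂ w₁≢w₂ y∈ w₁∈U w₂∈U)

    opaque
      fork-from : ∀ {x y z₁ z₂ R₁ R₂} → x ≢ y → z₁ ≢ z₂ → z₁ ≢ x → z₁ ≢ y → z₂ ≢ x → z₂ ≢ y →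
        τ x y z₁ ∈ F → τ x y z₂ ∈ F → R₁ ∈ F → x ∉ₛ R₁ → y ∉ₛ R₁ →
        R₂ ∈ F → x ∉ₛ R₂ → y ∉ₛ R₂ → R₁ ≢ R₂ → Absurd
      fork-from {x} {y} {z₁} {z₂} x≢y z₁≢z₂ z₁≢x z₁≢y z₂≢x z₂≢y S∈ T∈ R₁∈ x∉R₁ y∉R₁ R₂∈ x∉R₂ y∉R₂ R₁≢R₂
        with meets-third S∈ R₁∈ x∉R₁ y∉R₁ | meets-third T∈ R₁∈ x∉R₁ y∉R₁
           | meets-third S∈ R₂∈ x∉R₂ y∉R₂ | meets-third T∈ R₂∈ x∉R₂ y∉R₂
      ... | z₁∈R₁ | z₂∈R₁ | z₁∈R₂ | z₂∈R₂
        with third-vertex R₁∈ z₁∈R₁ z₂∈R₁ | third-vertex R₂∈ z₁∈R₂ z₂∈R₂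
      ... | w₁ , w₁∈ , w₁≢z₁ , w₁≢z₂ | w₂ , w₂∈ , w₂≢z₁ , w₂≢z₂
        with triple R₁∈ z₁≢z₂ (≢-sym w₁≢z₁) (≢-sym w₁≢z₂) z₁∈R₁ z₂∈R₁ w₁∈
           | triple R₂∈ z₁≢z₂ (≢-sym w₂≢z₁) (≢-sym w₂≢z₂) z₁∈R₂ z₂∈R₂ w₂∈
      ... | refl | refl = no-fork record
        { distinct = (x≢y ∷ ≢-sym z₁≢x ∷ ≢-sym z₂≢x ∷ (λ { refl → x∉R₁ w₁∈ }) ∷ (λ { refl → x∉R₂ w₂∈ }) ∷ []) ∷
            (≢-sym z₁≢y ∷ ≢-sym z₂≢y ∷ (λ { refl → y∉R₁ w₁∈ }) ∷ (λ { refl → y∉R₂ w₂∈ }) ∷ []) ∷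
            (z₁≢z₂ ∷ ≢-sym w₁≢z₁ ∷ ≢-sym w₂≢z₁ ∷ []) ∷ (≢-sym w₁≢z₂ ∷ ≢-sym w₂≢z₂ ∷ []) ∷
            ((λ { refl → R₁≢R₂ refl }) ∷ []) ∷ [] ∷ []
        ; xyz₁ = S∈ ; xyz₂ = T∈ ; zzw₁ = R₁∈ ; zzw₂ = R₂∈ }

    opaque
      -- For two distinct members through `x` and `y`, the number of members avoiding both decides:
      -- none or one gives a `Crossing`, two give a `Fork`.
      codegree-≤1 : ∀ {x y S T} → x ≢ y → Through x y S → Through x y T → S ≡ T
      codegree-≤1 {x} {y} {S} {T} x≢y (through S∈ x∈S y∈S) (through T∈ x∈T y∈T) with S ≟ˢ T
      ... | yes eq = eq
      ... | no S≢T with third-vertex S∈ x∈S y∈S | third-vertex T∈ x∈T y∈T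
      ... | z₁ , z₁∈ , z₁≢x , z₁≢y | z₂ , z₂∈ , z₂≢x , z₂≢y
        with triple S∈ x≢y (≢-sym z₁≢x) (≢-sym z₁≢y) x∈S y∈S z₁∈
           | triple T∈ x≢y (≢-sym z₂≢x) (≢-sym z₂≢y) x∈T y∈T z₂∈
      ... | refl | refl with anySubset? (λ R → mem? F R ×-dec ¬? (x ∈ₛ? R) ×-dec ¬? (y ∈ₛ? R))
      ... | no none = ⊥-elim (no-crossing record
            { x≠y = x≢y ; no-x = λ _ → no-pair _ _ ; no-y = λ _ → no-pair _ _
            ; slack = inj₁ λ {R} R∈ x∉ → decidable-stable (y ∈ₛ? R) λ y∉ → none (R , R∈ , x∉ , y∉) })
      ... | yes (R₁ , R₁∈ , x∉R₁ , y∉R₁)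
        with anySubset? (λ R → mem? F R ×-dec ¬? (x ∈ₛ? R) ×-dec ¬? (y ∈ₛ? R) ×-dec ¬? (R₁ ≟ˢ R))
      ... | no none = ⊥-elim (no-crossing record
            { x≠y = x≢y ; no-x = λ _ → no-pair _ _ ; no-y = λ _ → no-pair _ _
            ; slack = inj₂ ((pair∈H S∈ x∈S y∈S , no-pair x y) , R₁ , λ {R} R∈ x∉ y∉ →
                sym (decidable-stable (R₁ ≟ˢ R) λ R₁≢R → none (R , R∈ , x∉ , y∉ , R₁≢R))) })
      ... | yes (R₂ , R₂∈ , x∉R₂ , y∉R₂ , R₁≢R₂) = ⊥-elim (fork-from x≢y (λ { refl → S≢T refl })
              z₁≢x z₁≢y z₂≢x z₂≢y S∈ T∈ R₁∈ x∉R₁ y∉R₁ R₂∈ x∉R₂ y∉R₂ R₁≢R₂)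

    opaque
      at-most-one : ∀ {x y} → x ≢ y → ∃[ L ] length L ≤ 1 × (∀ {T} → T ∈ F → x ∈ₛ T → y ∈ₛ T → T ∈ˡ L)
      at-most-one {x} {y} x≢y with anySubset? (through? x y)
      ... | no none = [] , z≤n , λ T∈ x∈ y∈ → ⊥-elim (none (_ , through T∈ x∈ y∈))
      ... | yes (S , thS) = S ∷ [] , ≤-refl , λ T∈ x∈ y∈ → here (codegree-≤1 x≢y (through T∈ x∈ y∈) thS)

    opaque
      -- A member avoiding `a` contains one of `b`, `c` and one of `p`, `q`, and each of these four
      -- pairs lies in at most one member; but five sets are missing at `a`.
      two-disjoint-links : ∀ {a b c p q} → τ a b c ∈ F → τ a p q ∈ F →
        Unique (a ∷ b ∷ c ∷ p ∷ q ∷ []) → Absurd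
      two-disjoint-links {a} {b} {c} {p} {q} S∈ T∈
        u@(_ ∷ (_ ∷ b≢p ∷ b≢q ∷ []) ∷ (c≢p ∷ c≢q ∷ []) ∷ _)
        with at-most-one b≢p | at-most-one b≢q | at-most-one c≢p | at-most-one c≢q
      ... | L₁ , L₁≤ , in₁ | L₂ , L₂≤ , in₂ | L₃ , L₃≤ , in₃ | L₄ , L₄≤ , in₄
        = <⇒≱ (s≤s short) (exchange-pairs a u
            (at S∈ 0ᵗʰ ∷ at S∈ 1ˢᵗ ∷ at S∈ 2ⁿᵈ ∷ at T∈ 1ˢᵗ ∷ at T∈ 2ⁿᵈ ∷ []) cover)
        where
        L : List (Subset n)
        L = (L₁ ++ L₂) ++ (L₃ ++ L₄)
        short : length L ≤ 4
        short = ≤-trans (≤-reflexive (trans (length-++ (L₁ ++ L₂)) (cong₂ _+_ (length-++ L₁) (length-++ L₃))))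
                        (+-mono-≤ (+-mono-≤ L₁≤ L₂≤) (+-mono-≤ L₃≤ L₄≤))
        at : ∀ {l v} → ⟦ a ∷ l ⟧ ∈ F → v ∈ˡ a ∷ l → Missing a v
        at R∈ v∈ = pair∈H R∈ (∈⟦⟧⁺ 0ᵗʰ) (∈⟦⟧⁺ v∈) , no-pair _ _
        cover : Covers a L
        cover {U} U∈ a∉ with meets-list (a ∷ b ∷ c ∷ []) S∈ U∈ | meets-list (a ∷ p ∷ q ∷ []) T∈ U∈
        ... | _ , 0ᵗʰ , a∈ | _ = ⊥-elim (a∉ a∈)
        ... | _ , 1ˢᵗ , _ | _ , 0ᵗʰ , a∈ = ⊥-elim (a∉ a∈)
        ... | _ , 2ⁿᵈ , _ | _ , 0ᵗʰ , a∈ = ⊥-elim (a∉ a∈)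
        ... | _ , 1ˢᵗ , b∈ | _ , 1ˢᵗ , p∈ = ∈-++⁺ˡ (∈-++⁺ˡ (in₁ U∈ b∈ p∈))
        ... | _ , 1ˢᵗ , b∈ | _ , 2ⁿᵈ , q∈ = ∈-++⁺ˡ (∈-++⁺ʳ L₁ (in₂ U∈ b∈ q∈))
        ... | _ , 2ⁿᵈ , c∈ | _ , 1ˢᵗ , p∈ = ∈-++⁺ʳ (L₁ ++ L₂) (∈-++⁺ˡ (in₃ U∈ c∈ p∈))
        ... | _ , 2ⁿᵈ , c∈ | _ , 2ⁿᵈ , q∈ = ∈-++⁺ʳ (L₁ ++ L₂) (∈-++⁺ʳ L₃ (in₄ U∈ c∈ q∈))

    opaque
      -- A member and another that avoids one of its vertices meet in a single vertex `a`, by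
      -- `codegree-≤1`, and so give two disjoint edges at `a`.
      not-uniform : ∀ {S} → S ∈ F → Absurd
      not-uniform {S} S∈ with meet S∈ S∈
      ... | s , s∈ , _ with avoid s
      ... | T , T∈ , s∉T with meet S∈ T∈
      ... | a , a∈S , a∈T with vertex-beside S∈ a∈S | vertex-beside T∈ a∈T
      ... | b , b∈ , b≢a | p , p∈ , p≢a with third-vertex S∈ a∈S b∈ | third-vertex T∈ a∈T p∈
      ... | c , c∈ , c≢a , c≢b | q , q∈ , q≢a , q≢p
        with triple S∈ (≢-sym b≢a) (≢-sym c≢a) (≢-sym c≢b) a∈S b∈ c∈
           | triple T∈ (≢-sym p≢a) (≢-sym q≢a) (≢-sym q≢p) a∈T p∈ q∈
      ... | refl | refl = two-disjoint-links S∈ T∈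
            ((≢-sym b≢a ∷ ≢-sym c≢a ∷ ≢-sym p≢a ∷ ≢-sym q≢a ∷ []) ∷
             (≢-sym c≢b ∷ apart b∈ b≢a p∈ ∷ apart b∈ b≢a q∈ ∷ []) ∷
             (apart c∈ c≢a p∈ ∷ apart c∈ c≢a q∈ ∷ []) ∷ (≢-sym q≢p ∷ []) ∷ [] ∷ [])
        where
        apart : ∀ {v w} → v ∈ₛ τ a b c → v ≢ a → w ∈ₛ τ a p q → v ≢ w
        apart v∈ v≢a w∈ refl = s∉T (subst (s ∈ₛ_)
          (codegree-≤1 (≢-sym v≢a) (through S∈ a∈S v∈) (through T∈ a∈T w∈)) s∈)

  -- Elementary facts for families with pairs

  opaque
    pair-hits : ∀ {a b S} → π a b ∈ F → S ∈ F → a ∉ₛ S → b ∈ₛ S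
    pair-hits {a} {b} ab∈ S∈ a∉ with meets-list (a ∷ b ∷ []) ab∈ S∈
    ... | _ , 0ᵗʰ , a∈ = ⊥-elim (a∉ a∈)
    ... | _ , 1ˢᵗ , b∈ = b∈

  opaque
    -- The main source of missing pairs below, with a known pair or triple of `F` as `S`.
    pair-missed : ∀ {a b S} → S ∈ F → a ∉ₛ S → b ∉ₛ S → π a b ∉ F
    pair-missed S∈ a∉ b∉ ab∈ = b∉ (pair-hits ab∈ S∈ a∉)

  opaque
    ∉π : ∀ {a b v : Fin n} → v ≢ a → v ≢ b → v ∉ₛ π a b
    ∉π {a} {b} v≢a v≢b v∈ with ∈⟦⟧⁻ (a ∷ b ∷ []) v∈
    ... | 0ᵗʰ = v≢a refl
    ... | 1ˢᵗ = v≢b refl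

  opaque
    ∉τ : ∀ {a b c v : Fin n} → v ≢ a → v ≢ b → v ≢ c → v ∉ₛ τ a b c
    ∉τ {a} {b} {c} v≢a v≢b v≢c v∈ with ∈⟦⟧⁻ (a ∷ b ∷ c ∷ []) v∈
    ... | 0ᵗʰ = v≢a refl
    ... | 1ˢᵗ = v≢b refl
    ... | 2ⁿᵈ = v≢c refl

  opaque
    τ-swap₁₂ : (a b c : Fin n) → τ a b c ≡ τ b a c
    τ-swap₁₂ a b c = ⟦⟧-cong (1ˢᵗ ∷ 0ᵗʰ ∷ 2ⁿᵈ ∷ []) (1ˢᵗ ∷ 0ᵗʰ ∷ 2ⁿᵈ ∷ [])

  opaque
    τ-swap₂₃ : (a b c : Fin n) → τ a b c ≡ τ a c b
    τ-swap₂₃ a b c = ⟦⟧-cong (0ᵗʰ ∷ 2ⁿᵈ ∷ 1ˢᵗ ∷ []) (0ᵗʰ ∷ 2ⁿᵈ ∷ 1ˢᵗ ∷ [])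

  opaque
    xx∈H : ∀ {x v} → π x v ∈ F → π x x ∈ H
    xx∈H S∈ = pair∈H S∈ (∈⟦⟧⁺ 0ᵗʰ) (∈⟦⟧⁺ 0ᵗʰ)

  -- Triangles of pairs

  record Triangle (x y u : Fin n) : Set where
    field
      x≢y : x ≢ y
      x≢u : x ≢ u
      y≢u : y ≢ u
      xy  : π x y ∈ F
      xu  : π x u ∈ F
      yu  : π y u ∈ F

  module _ {x y u} (t : Triangle x y u) where
    open Triangle t

    opaque
      triangle-cover : Covers x (spans y u (links y x u))
      triangle-cover {S} S∈ x∉ with S ≟ˢ π y u
      ... | yes eq = here eq
      ... | no S≢ = there (link-member (≢-sym y≢u) S∈ (pair-hits xy S∈ x∉) x∉ (pair-hits xu S∈ x∉) S≢)

    -- Each such `w` gives a pair with `x` that lies in `H` but, being disjoint from `π y u`, not in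
    -- `F`.
    Linked : Fin n → Set
    Linked w = Link x u y w ⊎ Link x y u w

    linked? : ∀ w → Dec (Linked w)
    linked? w = link? x u y w ⊎-dec link? x y u w

    linked : List (Fin n)
    linked = filter linked? (allFin n)

    opaque
      linked-apart : ∀ {w} → Linked w → x ≢ w × y ≢ w × u ≢ w
      linked-apart (inj₁ (_ , x≢ , u≢ , y≢)) = x≢ , y≢ , u≢
      linked-apart (inj₂ (_ , x≢ , y≢ , u≢)) = x≢ , y≢ , u≢

    opaque
      linked-missing : ∀ {w} → Linked w → Missing x w
      linked-missing {w} lw with linked-apart lw
      ... | x≢w , y≢w , u≢w = in-H lw
          , pair-missed yu (∉π x≢y x≢u) (∉π (≢-sym y≢w) (≢-sym u≢w))
        where
        in-H : ∀ {w} → Linked w → π x w ∈ H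
        in-H (inj₁ (S∈ , _)) = pair∈H S∈ (∈⟦⟧⁺ 0ᵗʰ) (∈⟦⟧⁺ 2ⁿᵈ)
        in-H (inj₂ (S∈ , _)) = pair∈H S∈ (∈⟦⟧⁺ 0ᵗʰ) (∈⟦⟧⁺ 2ⁿᵈ)

    opaque
      linked⁻ : ∀ {w} → w ∈ˡ linked → Linked w
      linked⁻ w∈ = proj₂ (∈-filter⁻ linked? {xs = allFin n} w∈)

    opaque
      x∷linked-unique : Unique (x ∷ linked)
      x∷linked-unique = All.tabulate (λ w∈ → proj₁ (linked-apart (linked⁻ w∈))) ∷ Uniq.filter⁺ linked? (Uniq.allFin⁺ n)

    opaque
      x∷linked-missing : All (Missing x) (x ∷ linked)
      x∷linked-missing = (xx∈H xy , no-singleton x) ∷ All.tabulate (λ w∈ → linked-missing (linked⁻ w∈))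

    opaque
      length-spans : ∀ (a b : Fin n) W → length (spans a b W) ≡ suc (length W)
      length-spans a b W = cong suc (length-map (τ a b) W)

    opaque
      -- Exchange at `x`, where the missing singleton of `x` and the member `π y u` cancel.
      linked≤links : length linked ≤ length (links y x u)
      linked≤links = ≤-pred (≤-trans
        (exchange-pairs x x∷linked-unique x∷linked-missing triangle-cover)
        (≤-reflexive (length-spans y u (links y x u))))

    opaque
      -- The whole triple is then one more missing set at `x`.
      linked<links : τ x y u ∈ H → τ x y u ∉ F → length linked < length (links y x u)
      linked<links K∈H K∉F = ≤-pred (≤-trans
        (≤-trans (≤-reflexive (cong (2 +_) (sym (length-map (π x) linked))))
          (exchange x {τ x y u ∷ map (π x) (x ∷ linked)}
            (All.tabulate fresh ∷ Uniq.map⁺ (π-injective x) x∷linked-unique) ok triangle-cover))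
        (≤-reflexive (length-spans y u (links y x u))))
        where
        fresh : ∀ {S} → S ∈ˡ map (π x) (x ∷ linked) → τ x y u ≢ S
        fresh S∈ refl with ∈-map⁻ (π x) S∈
        ... | w , _ , eq with ∈⟦⟧⁻ (x ∷ w ∷ []) (subst (y ∈ₛ_) eq (∈⟦⟧⁺ 1ˢᵗ))
                            | ∈⟦⟧⁻ (x ∷ w ∷ []) (subst (u ∈ₛ_) eq (∈⟦⟧⁺ 2ⁿᵈ))
        ...   | 0ᵗʰ | _ = x≢y refl
        ...   | 1ˢᵗ | 0ᵗʰ = x≢u refl
        ...   | 1ˢᵗ | 1ˢᵗ = y≢u refl
        ok : ∀ {S} → S ∈ˡ τ x y u ∷ map (π x) (x ∷ linked) → (S ∈ H × x ∈ₛ S) × S ∉ F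
        ok (here refl) = (K∈H , ∈⟦⟧⁺ 0ᵗʰ) , K∉F
        ok (there S∈) = pairs-missing x x∷linked-missing S∈

    opaque
      links≤linkedˡ : length (links x u y) ≤ length linked
      links≤linkedˡ = unique-⊆⇒length≤ (links-unique x u y) λ w∈ →
        ∈-filter⁺ linked? (∈-allFin _) (inj₁ (links⁻ x u y w∈))

    opaque
      links≤linkedʳ : length (links x y u) ≤ length linked
      links≤linkedʳ = unique-⊆⇒length≤ (links-unique x y u) λ w∈ →
        ∈-filter⁺ linked? (∈-allFin _) (inj₂ (links⁻ x y u w∈))

  opaque
    Link-swap : ∀ {a b c w} → Link a b c w → Link c b a w
    Link-swap {a} {b} {c} {w} (S∈ , a≢ , b≢ , c≢) = subst (_∈ F) (τ-swap₁₂ a c w) S∈ , c≢ , b≢ , a≢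

  opaque
    links-swap : ∀ a b c → length (links a b c) ≤ length (links c b a)
    links-swap a b c = unique-⊆⇒length≤ (links-unique a b c) λ w∈ →
      ∈-filter⁺ (link? c b a) (∈-allFin _) (Link-swap (links⁻ a b c w∈))

  opaque
    rotate : ∀ {x y u} → Triangle x y u → Triangle y u x
    rotate {x} {y} {u} t = record
      { x≢y = y≢u ; x≢u = ≢-sym x≢y ; y≢u = ≢-sym x≢u
      ; xy = yu ; xu = subst (_∈ F) (π-swap x y) xy ; yu = subst (_∈ F) (π-swap x u) xu }
      where open Triangle t

  -- Each linked list contains two of the three link lists and is no longer
  -- than the third, so all of them have the same length.
  module _ {x y u} (t : Triangle x y u) where

    open Triangle t
    private
      t₁ = rotate t
      t₂ = rotate t₁
      W = links x u y
      K = τ x y u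

    opaque
      yu≤xu : length (links y x u) ≤ length (links x y u)
      yu≤xu = ≤-trans (links≤linkedˡ t₁) (≤-trans (linked≤links t₁) (links-swap u y x))

    opaque
      xu≤xy : length (links x y u) ≤ length (links x u y)
      xu≤xy = ≤-trans (links-swap x y u) (≤-trans (links≤linkedˡ t₂) (linked≤links t₂))

    opaque
      xy≤yu : length (links x u y) ≤ length (links y x u)
      xy≤yu = ≤-trans (links≤linkedˡ t) (linked≤links t)

    opaque
      -- Were `K` missing, the comparison at `x` would be strict, against the equality of the
      -- lengths.
      K∈F : K ∈ H → K ∈ F
      K∈F K∈H = decidable-stable (mem? F K) λ K∉F →
        <⇒≱ (linked<links t K∈H K∉F) (≤-trans yu≤xu (links≤linkedʳ t))

    opaque
      xy⇒xu : ∀ {w} → Link x u y w → Link x y u w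
      xy⇒xu lw = filter-length-≤⇒⊆ (link? x y u) (linked? t) inj₂
        (≤-trans (linked≤links t) yu≤xu) (inj₁ lw)

    opaque
      xu⇒xy : ∀ {w} → Link x y u w → Link x u y w
      xu⇒xy lw = filter-length-≤⇒⊆ (link? x u y) (linked? t) inj₁
        (≤-trans (linked≤links t) (≤-trans yu≤xu xu≤xy)) (inj₂ lw)

    opaque
      yu⇔xy : ∀ {w} → (Link y x u w → Link x u y w) × (Link x u y w → Link y x u w)
      yu⇔xy = (λ lw → Link-swap (filter-length-≤⇒⊆ (link? y u x) (linked? t₁) inj₂
                  (≤-trans (linked≤links t₁) (≤-trans (links-swap u y x) (≤-trans xu≤xy (links-swap x u y)))) (inj₁ lw)))
            , (λ lw → filter-length-≤⇒⊆ (link? y x u) (linked? t₁) inj₁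
                  (≤-trans (linked≤links t₁) (≤-trans (links-swap u y x) (≤-trans xu≤xy xy≤yu))) (inj₂ (Link-swap lw)))

    opaque
      W⁻ : ∀ {m} → m ∈ˡ W → Link x u y m
      W⁻ = links⁻ x u y

    opaque
      W∉K : ∀ {m} → m ∈ˡ W → m ∉ₛ K
      W∉K m∈ with W⁻ m∈
      ... | _ , x≢m , u≢m , y≢m = ∉τ (≢-sym x≢m) (≢-sym y≢m) (≢-sym u≢m)

    private
      Spanned : Subset n → Set
      Spanned Z = Z ∈ˡ spans x y W ⊎ Z ∈ˡ spans x u W ⊎ Z ∈ˡ spans y u W

    opaque
      spanned⇒F : ∀ {Z} → Spanned Z → Z ∈ F
      spanned⇒F (inj₁ Z∈) with spans-shape Z∈
      ... | inj₁ refl = xy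
      ... | inj₂ (m , m∈ , refl) = proj₁ (W⁻ m∈)
      spanned⇒F (inj₂ (inj₁ Z∈)) with spans-shape Z∈
      ... | inj₁ refl = xu
      ... | inj₂ (m , m∈ , refl) = proj₁ (xy⇒xu (W⁻ m∈))
      spanned⇒F (inj₂ (inj₂ Z∈)) with spans-shape Z∈
      ... | inj₁ refl = yu
      ... | inj₂ (m , m∈ , refl) = proj₁ (proj₂ yu⇔xy (W⁻ m∈))

    opaque
      respan : ∀ {a b W′ Z} → (∀ {m} → m ∈ˡ W′ → m ∈ˡ W) → Z ∈ˡ spans a b W′ → Z ∈ˡ spans a b W
      respan {a} {b} incl Z∈ with spans-shape Z∈
      ... | inj₁ refl = 0ᵗʰ
      ... | inj₂ (m , m∈ , refl) = there (∈-map⁺ (τ a b) (incl m∈))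

    opaque
      -- A member other than `K` omits a vertex of the triangle, and the cover at that vertex lists
      -- it.
      F⇒spanned : ∀ {Z} → Z ∈ F → Z ≢ K → Spanned Z
      F⇒spanned {Z} Z∈ Z≢K with x ∈ₛ? Z | y ∈ₛ? Z | u ∈ₛ? Z
      ... | yes x∈ | yes y∈ | yes u∈ = ⊥-elim (Z≢K (triple Z∈ x≢y x≢u y≢u x∈ y∈ u∈))
      ... | no x∉ | _ | _ = inj₂ (inj₂ (respan (λ m∈ → to (proj₁ yu⇔xy (links⁻ y x u m∈))) (triangle-cover t Z∈ x∉)))
        where
        to : ∀ {m} → Link x u y m → m ∈ˡ W
        to l = ∈-filter⁺ (link? x u y) (∈-allFin _) l
      ... | yes _ | no y∉ | _ = inj₂ (inj₁ (flip-span (respan to (triangle-cover t₁ Z∈ y∉))))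
        where
        to : ∀ {m} → m ∈ˡ links u y x → m ∈ˡ W
        to m∈ = ∈-filter⁺ (link? x u y) (∈-allFin _) (xu⇒xy (Link-swap (links⁻ u y x m∈)))
        flip-span : ∀ {Z} → Z ∈ˡ spans u x W → Z ∈ˡ spans x u W
        flip-span Z∈ with spans-shape Z∈
        ... | inj₁ refl = here (π-swap u x)
        ... | inj₂ (m , m∈ , refl) = there (subst (_∈ˡ map (τ x u) W) (τ-swap₁₂ x u m) (∈-map⁺ (τ x u) m∈))
      ... | yes _ | yes _ | no u∉ = inj₁ (triangle-cover t₂ Z∈ u∉)

    opaque
      triangle-exceptional : Exceptional H F
      triangle-exceptional = K , ⟦ W ⟧ , ∣⟦⟧∣ ((x≢y ∷ x≢u ∷ []) ∷ (y≢u ∷ []) ∷ [] ∷ [])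
        , (λ m∈ → x∉p⇒x∈∁p (W∉K (∈⟦⟧⁻ W m∈)))
        , (λ Z∈ → F⊆H (𝒵⊆F Z∈))
        , size-𝒵 x≢y x≢u y≢u (links-unique x u y) W∉K
        , sizes
        , x , star-size
        where
        𝒵⊆F : ∀ {Z} → Z ∈ 𝒵 K ⟦ W ⟧ → Z ∈ F
        𝒵⊆F Z∈ = spanned⇒F (𝒵⇒spans x≢y x≢u y≢u (links-unique x u y) W∉K Z∈)
        F⊆𝒵 : ∀ {Z} → Z ∈ F → Z ≢ K → Z ∈ 𝒵 K ⟦ W ⟧
        F⊆𝒵 Z∈ Z≢K = spans⇒𝒵 x≢y x≢u y≢u (links-unique x u y) W∉K (F⇒spanned Z∈ Z≢K)
        K∉𝒵 : K ∉ 𝒵 K ⟦ W ⟧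
        K∉𝒵 Z∈ with 𝒵⇒spans x≢y x≢u y≢u (links-unique x u y) W∉K Z∈
        ... | inj₁ p = spans-excludes (≢-sym x≢u) (≢-sym y≢u) (λ m∈ → W∉K m∈ (∈⟦⟧⁺ 2ⁿᵈ)) p (∈⟦⟧⁺ 2ⁿᵈ)
        ... | inj₂ (inj₁ p) = spans-excludes (≢-sym x≢y) y≢u (λ m∈ → W∉K m∈ (∈⟦⟧⁺ 1ˢᵗ)) p (∈⟦⟧⁺ 1ˢᵗ)
        ... | inj₂ (inj₂ p) = spans-excludes x≢y x≢u (λ m∈ → W∉K m∈ (∈⟦⟧⁺ 0ᵗʰ)) p (∈⟦⟧⁺ 0ᵗʰ)
        sizes : (K ∉ H × size F ≡ size (𝒵 K ⟦ W ⟧)) ⊎ (K ∈ H × size F ≡ size (𝒵 K ⟦ W ⟧) + 1)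
        sizes with mem? H K
        -- With both lists empty, `size-exchange` says that `size` is monotone.
        ... | no K∉H = inj₁ (K∉H , ≤-antisym
              (+-cancelʳ-≤ 0 _ _ (size-exchange F (𝒵 K ⟦ W ⟧) [] [] [] (λ ())
                λ Z∈ → inj₁ (F⊆𝒵 Z∈ λ { refl → K∉H (F⊆H Z∈) })))
              (+-cancelʳ-≤ 0 _ _ (size-exchange (𝒵 K ⟦ W ⟧) F [] [] [] (λ ()) (inj₁ ∘ 𝒵⊆F))))
        ... | yes K∈H = inj₂ (K∈H , ≤-antisym
              (≤-trans (≤-reflexive (sym (+-identityʳ (size F))))
                (size-exchange F (𝒵 K ⟦ W ⟧) [] (K ∷ []) [] (λ ()) split))
              (≤-trans (size-exchange (𝒵 K ⟦ W ⟧) F (K ∷ []) [] ([] ∷ [])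
                  (λ { 0ᵗʰ → K∈F K∈H , K∉𝒵 }) (inj₁ ∘ 𝒵⊆F))
                (≤-reflexive (+-identityʳ (size F)))))
          where
          split : ∀ {Z} → Z ∈ F → Z ∈ 𝒵 K ⟦ W ⟧ ⊎ Z ∈ˡ K ∷ []
          split {Z} Z∈ with Z ≟ˢ K
          ... | yes eq = inj₂ (here eq)
          ... | no Z≢K = inj₁ (F⊆𝒵 Z∈ Z≢K)
        star-size : size F ≤ size (star H x)
        -- By the equality of the lengths, the listed missing sets at `x` are at least as many as
        -- the members avoiding `x`, so they cancel in the exchange.
        star-size = +-cancelʳ-≤ (length (x ∷ linked t)) _ _ (≤-trans
          (≤-trans (≤-reflexive (cong (size F +_) (sym (length-map (π x) (x ∷ linked t)))))
            (exchange-sizes x (Uniq.map⁺ (π-injective x) (x∷linked-unique t)) (pairs-missing x (x∷linked-missing t))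
              (triangle-cover t)))
          (+-monoʳ-≤ (size (star H x)) (≤-trans (≤-reflexive (length-spans t y u (links y x u)))
            (s≤s (≤-trans yu≤xu (links≤linkedʳ t))))))

  -- Three pairs through one vertex

  record Cherry (x y u v : Fin n) : Set where
    field
      distinct : Unique (x ∷ y ∷ u ∷ v ∷ [])
      xy : π x y ∈ F
      xu : π x u ∈ F
      xv : π x v ∈ F

  cherry-rotate : ∀ {x y u v} → Cherry x y u v → Cherry x u v y
  cherry-rotate c with Cherry.distinct c
  ... | (x≢y ∷ x≢u ∷ x≢v ∷ []) ∷ (y≢u ∷ y≢v ∷ []) ∷ (u≢v ∷ []) ∷ [] ∷ [] = record
    { distinct = (x≢u ∷ x≢v ∷ x≢y ∷ []) ∷ (u≢v ∷ ≢-sym y≢u ∷ []) ∷ (≢-sym y≢v ∷ []) ∷ [] ∷ []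
    ; xy = Cherry.xu c ; xu = Cherry.xv c ; xv = Cherry.xy c }

  module _ {x y u v} (c : Cherry x y u v) where
    open Cherry c

    opaque
      cherry-cover : Covers x (τ y u v ∷ [])
      cherry-cover S∈ x∉ with distinct
      ... | _ ∷ (y≢u ∷ y≢v ∷ []) ∷ (u≢v ∷ []) ∷ _ =
        here (triple S∈ y≢u y≢v u≢v (pair-hits xy S∈ x∉) (pair-hits xu S∈ x∉) (pair-hits xv S∈ x∉))

    opaque
      yuv∈ : τ y u v ∈ F
      yuv∈ with avoid x
      ... | S , S∈ , x∉ with cherry-cover S∈ x∉
      ...   | 0ᵗʰ = S∈

    opaque
      -- Only `τ y u v` avoids `x`, so at most one set is missing at `x`, and the singleton of `x`
      -- is already one.
      cherry-star : ∀ {T} → T ∈ H → x ∈ₛ T → T ≢ π x x → T ∈ F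
      cherry-star {T} T∈H x∈ T≢ = decidable-stable (mem? F T) λ T∉F →
        <⇒≱ ≤-refl (exchange x {π x x ∷ T ∷ []} ((≢-sym T≢ ∷ []) ∷ [] ∷ [])
          (λ { 0ᵗʰ → (xx∈H xy , ∈⟦⟧⁺ 0ᵗʰ) , no-singleton x ; 1ˢᵗ → (T∈H , x∈) , T∉F }) cherry-cover)

    opaque
      -- Any further `w` would form with `x` a pair that is in `F` by `cherry-star` yet disjoint
      -- from `τ y u v`.
      cherry-vertices : ∀ {S w} → S ∈ F → x ∈ₛ S → w ∈ₛ S → w ∈ˡ x ∷ y ∷ u ∷ v ∷ []
      cherry-vertices {S} {w} S∈ x∈ w∈ with w ≟ᶠ x
      ... | yes refl = 0ᵗʰ
      ... | no w≢x = there (decidable-stable (mem-list? _≟ᶠ_ w (y ∷ u ∷ v ∷ [])) λ w∉ → absurd (¬Any⇒All¬ _ w∉))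
        where
        absurd : All (w ≢_) (y ∷ u ∷ v ∷ []) → Absurd
        absurd (w≢y ∷ w≢u ∷ w≢v ∷ []) with distinct
        ... | (x≢y ∷ x≢u ∷ x≢v ∷ []) ∷ _ = pair-missed yuv∈ (∉τ x≢y x≢u x≢v) (∉τ w≢y w≢u w≢v)
          (cherry-star (pair∈H S∈ x∈ w∈) (∈⟦⟧⁺ 0ᵗʰ) λ eq → w≢x (π-injective x eq))

    opaque
      -- Otherwise only `π x u` and `π x v` could avoid `y`, while the singleton of `y` and its
      -- pairs with `u` and `v` are missing: three against two.
      cherry-triple : τ x u v ∈ F
      cherry-triple with distinct
      ... | (x≢y ∷ x≢u ∷ x≢v ∷ []) ∷ (y≢u ∷ y≢v ∷ []) ∷ (u≢v ∷ []) ∷ _ =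
        decidable-stable (mem? F (τ x u v)) λ xuv∉ →
          <⇒≱ ≤-refl (exchange-pairs y ((y≢u ∷ y≢v ∷ []) ∷ (u≢v ∷ []) ∷ [] ∷ [])
            ((pair∈H yuv∈ (∈⟦⟧⁺ 0ᵗʰ) (∈⟦⟧⁺ 0ᵗʰ) , no-singleton y)
             ∷ (pair∈H yuv∈ (∈⟦⟧⁺ 0ᵗʰ) (∈⟦⟧⁺ 1ˢᵗ) , pair-missed xv (∉π (≢-sym x≢y) y≢v) (∉π (≢-sym x≢u) u≢v))
             ∷ (pair∈H yuv∈ (∈⟦⟧⁺ 0ᵗʰ) (∈⟦⟧⁺ 2ⁿᵈ) , pair-missed xu (∉π (≢-sym x≢y) y≢u) (∉π (≢-sym x≢v) (≢-sym u≢v)))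
             ∷ [])
            (cover xuv∉))
        where
        cover : τ x u v ∉ F → Covers y (π x u ∷ π x v ∷ [])
        cover xuv∉ {S} S∈ y∉ with distinct
        ... | (x≢y ∷ x≢u ∷ x≢v ∷ []) ∷ _ ∷ (u≢v ∷ []) ∷ _
          with S ≟ˢ π x u | S ≟ˢ π x v | pair-hits (subst (_∈ F) (π-swap x y) xy) S∈ y∉
        ... | yes eq | _ | _ = here eq
        ... | _ | yes eq | _ = there (here eq)
        ... | no S≢xu | no S≢xv | x∈ with vertex-beside S∈ x∈
        ...   | w , w∈ , w≢x with cherry-vertices S∈ x∈ w∈
        ...     | 0ᵗʰ = ⊥-elim (w≢x refl)
        ...     | 1ˢᵗ = ⊥-elim (y∉ w∈)
        ...     | 2ⁿᵈ = ⊥-elim (xuv∉ (subst (_∈ F) (triple S∈ x≢u x≢v u≢v x∈ w∈ v∈) S∈))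
          where
          v∈ : v ∈ₛ S
          v∈ with further-element (x∈ ∷ w∈ ∷ []) S≢xu
          ... | z , z∈ , (z≢x ∷ z≢u ∷ []) with cherry-vertices S∈ x∈ z∈
          ...   | 0ᵗʰ = ⊥-elim (z≢x refl)
          ...   | 1ˢᵗ = ⊥-elim (y∉ z∈)
          ...   | 2ⁿᵈ = ⊥-elim (z≢u refl)
          ...   | 3ʳᵈ = z∈
        ...     | 3ʳᵈ = ⊥-elim (xuv∉ (subst (_∈ F) (triple S∈ x≢u x≢v u≢v x∈ u∈ w∈) S∈))
          where
          u∈ : u ∈ₛ S
          u∈ with further-element (x∈ ∷ w∈ ∷ []) S≢xv
          ... | z , z∈ , (z≢x ∷ z≢v ∷ []) with cherry-vertices S∈ x∈ z∈
          ...   | 0ᵗʰ = ⊥-elim (z≢x refl)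
          ...   | 1ˢᵗ = ⊥-elim (y∉ z∈)
          ...   | 2ⁿᵈ = z∈
          ...   | 3ʳᵈ = ⊥-elim (z≢v refl)

  -- F is 𝒵 {x,y,u} {v} together with {x,y,u}, except that {x,v} replaces {y,u}.
  module _ {x y u v} (c : Cherry x y u v) where
    open Cherry c
    private
      K = τ x y u

      Spanned : Subset n → Set
      Spanned Z = Z ∈ˡ spans x y (v ∷ []) ⊎ Z ∈ˡ spans x u (v ∷ []) ⊎ Z ∈ˡ spans y u (v ∷ [])

    opaque
      spanned⇒cherry : ∀ {Z} → Spanned Z → Z ∈ F ⊎ Z ∈ˡ π y u ∷ []
      spanned⇒cherry (inj₁ 0ᵗʰ) = inj₁ xy
      spanned⇒cherry (inj₁ 1ˢᵗ) = inj₁ (subst (_∈ F) (τ-swap₂₃ x v y) (cherry-triple (cherry-rotate c)))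
      spanned⇒cherry (inj₂ (inj₁ 0ᵗʰ)) = inj₁ xu
      spanned⇒cherry (inj₂ (inj₁ 1ˢᵗ)) = inj₁ (cherry-triple c)
      spanned⇒cherry (inj₂ (inj₂ 0ᵗʰ)) = inj₂ 0ᵗʰ
      spanned⇒cherry (inj₂ (inj₂ 1ˢᵗ)) = inj₁ (yuv∈ c)

    opaque
      cherry-K∈F : K ∈ F
      cherry-K∈F = cherry-triple (cherry-rotate (cherry-rotate c))

    opaque
      pair-≡ : ∀ {S : Subset n} {a b} → a ∈ₛ S → b ∈ₛ S → (∀ {w} → w ∈ₛ S → w ≡ a ⊎ w ≡ b) → S ≡ π a b
      pair-≡ a∈ b∈ only = ⊆-antisym
        (λ w∈ → [ (λ { refl → ∈⟦⟧⁺ 0ᵗʰ }) , (λ { refl → ∈⟦⟧⁺ 1ˢᵗ }) ]′ (only w∈)) (⟦⟧-⊆ (a∈ ∷ b∈ ∷ []))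

    opaque
      cherry⇒spanned : ∀ {S} → S ∈ F → Spanned S ⊎ S ∈ˡ K ∷ π x v ∷ []
      cherry⇒spanned {S} S∈ with x ∈ₛ? S
      ... | no x∉ = inj₁ (inj₂ (inj₂ (there (cherry-cover c S∈ x∉))))
      ... | yes x∈ with distinct
      ... | (x≢y ∷ x≢u ∷ x≢v ∷ []) ∷ (y≢u ∷ y≢v ∷ []) ∷ (u≢v ∷ []) ∷ _ with y ∈ₛ? S | u ∈ₛ? S | v ∈ₛ? S
      ... | yes y∈ | yes u∈ | _ = inj₂ (here (triple S∈ x≢y x≢u y≢u x∈ y∈ u∈))
      ... | yes y∈ | no _ | yes v∈ = inj₁ (inj₁ (there (here (triple S∈ x≢y x≢v y≢v x∈ y∈ v∈))))
      ... | no _ | yes u∈ | yes v∈ = inj₁ (inj₂ (inj₁ (there (here (triple S∈ x≢u x≢v u≢v x∈ u∈ v∈)))))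
      ... | yes y∈ | no u∉ | no v∉ = inj₁ (inj₁ (here (pair-≡ x∈ y∈ only)))
        where
        only : ∀ {w} → w ∈ₛ S → w ≡ x ⊎ w ≡ y
        only w∈ with cherry-vertices c S∈ x∈ w∈
        ... | 0ᵗʰ = inj₁ refl
        ... | 1ˢᵗ = inj₂ refl
        ... | 2ⁿᵈ = ⊥-elim (u∉ w∈)
        ... | 3ʳᵈ = ⊥-elim (v∉ w∈)
      ... | no y∉ | yes u∈ | no v∉ = inj₁ (inj₂ (inj₁ (here (pair-≡ x∈ u∈ only))))
        where
        only : ∀ {w} → w ∈ₛ S → w ≡ x ⊎ w ≡ u
        only w∈ with cherry-vertices c S∈ x∈ w∈
        ... | 0ᵗʰ = inj₁ refl
        ... | 1ˢᵗ = ⊥-elim (y∉ w∈)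
        ... | 2ⁿᵈ = inj₂ refl
        ... | 3ʳᵈ = ⊥-elim (v∉ w∈)
      ... | no y∉ | no u∉ | yes v∈ = inj₂ (there (here (pair-≡ x∈ v∈ only)))
        where
        only : ∀ {w} → w ∈ₛ S → w ≡ x ⊎ w ≡ v
        only w∈ with cherry-vertices c S∈ x∈ w∈
        ... | 0ᵗʰ = inj₁ refl
        ... | 1ˢᵗ = ⊥-elim (y∉ w∈)
        ... | 2ⁿᵈ = ⊥-elim (u∉ w∈)
        ... | 3ʳᵈ = inj₂ refl
      ... | no y∉ | no u∉ | no v∉ with vertex-beside S∈ x∈
      ...   | w , w∈ , w≢x with cherry-vertices c S∈ x∈ w∈
      ...     | 0ᵗʰ = ⊥-elim (w≢x refl)
      ...     | 1ˢᵗ = ⊥-elim (y∉ w∈)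
      ...     | 2ⁿᵈ = ⊥-elim (u∉ w∈)
      ...     | 3ʳᵈ = ⊥-elim (v∉ w∈)

    opaque
      cherry-exceptional : Exceptional H F
      cherry-exceptional with distinct
      ... | (x≢y ∷ x≢u ∷ x≢v ∷ []) ∷ (y≢u ∷ y≢v ∷ []) ∷ (u≢v ∷ []) ∷ _ = K , M , ∣K∣
        , (λ m∈ → x∉p⇒x∈∁p (v∉K (∈⟦⟧⁻ (v ∷ []) m∈)))
        , (λ Z∈ → [ F⊆H , (λ { 0ᵗʰ → pair∈H (yuv∈ c) (∈⟦⟧⁺ 0ᵗʰ) (∈⟦⟧⁺ 1ˢᵗ) }) ]′ (𝒵⇒F Z∈))
        , size-𝒵 x≢y x≢u y≢u ([] ∷ []) v∉K
        , inj₂ (F⊆H cherry-K∈F , +-cancelʳ-≡ 1 _ _ (trans sizes (sym (+-assoc (size (𝒵 K M)) 1 1))))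
        -- The missing singleton of `x` cancels against `τ y u v`, the one member avoiding `x`.
        , x , +-cancelʳ-≤ 1 _ _ (exchange-sizes x {π x x ∷ []} ([] ∷ [])
                (λ { 0ᵗʰ → (xx∈H xy , ∈⟦⟧⁺ 0ᵗʰ) , no-singleton x }) (cherry-cover c))
        where
        M : Subset n
        M = ⟦ v ∷ [] ⟧
        ∣K∣ : ∣ K ∣ ≡ 3
        ∣K∣ = ∣⟦⟧∣ ((x≢y ∷ x≢u ∷ []) ∷ (y≢u ∷ []) ∷ [] ∷ [])
        v∉K : ∀ {m} → m ∈ˡ v ∷ [] → m ∉ₛ K
        v∉K 0ᵗʰ = ∉τ (≢-sym x≢v) (≢-sym y≢v) (≢-sym u≢v)
        𝒵⇒F : ∀ {Z} → Z ∈ 𝒵 K M → Z ∈ F ⊎ Z ∈ˡ π y u ∷ []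
        𝒵⇒F Z∈ = spanned⇒cherry (𝒵⇒spans x≢y x≢u y≢u ([] ∷ []) v∉K Z∈)
        F⇒𝒵 : ∀ {Z} → Z ∈ F → Z ∈ 𝒵 K M ⊎ Z ∈ˡ K ∷ π x v ∷ []
        F⇒𝒵 Z∈ = Sum.map₁ (spans⇒𝒵 x≢y x≢u y≢u ([] ∷ []) v∉K) (cherry⇒spanned Z∈)
        K∉𝒵 : K ∉ 𝒵 K M
        K∉𝒵 Z∈ with 𝒵⇒spans x≢y x≢u y≢u ([] ∷ []) v∉K Z∈
        ... | inj₁ p = spans-excludes (≢-sym x≢u) (≢-sym y≢u) (λ { 0ᵗʰ → u≢v refl }) p (∈⟦⟧⁺ 2ⁿᵈ)
        ... | inj₂ (inj₁ p) = spans-excludes (≢-sym x≢y) y≢u (λ { 0ᵗʰ → y≢v refl }) p (∈⟦⟧⁺ 1ˢᵗ)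
        ... | inj₂ (inj₂ p) = spans-excludes x≢y x≢u (λ { 0ᵗʰ → x≢v refl }) p (∈⟦⟧⁺ 0ᵗʰ)
        xv∉𝒵 : π x v ∉ 𝒵 K M
        xv∉𝒵 Z∈ with 𝒵⇒spans x≢y x≢u y≢u ([] ∷ []) v∉K Z∈
        ... | inj₁ p = ∉π (≢-sym x≢y) y≢v (proj₂ (spans-contains p))
        ... | inj₂ (inj₁ p) = ∉π (≢-sym x≢u) u≢v (proj₂ (spans-contains p))
        ... | inj₂ (inj₂ p) = ∉π (≢-sym x≢y) y≢v (proj₁ (spans-contains p))
        K≢xv : K ≢ π x v
        K≢xv eq = ∉π (≢-sym x≢y) y≢v (subst (y ∈ₛ_) eq (∈⟦⟧⁺ 1ˢᵗ))
        yu∉F : π y u ∉ F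
        yu∉F = pair-missed xv (∉π (≢-sym x≢y) y≢v) (∉π (≢-sym x≢u) u≢v)
        sizes : size F + 1 ≡ size (𝒵 K M) + 2
        sizes = ≤-antisym
          (size-exchange F (𝒵 K M) (π y u ∷ []) (K ∷ π x v ∷ []) ([] ∷ [])
            (λ { 0ᵗʰ → inj₁ (⟦⟧-⊆ (∈⟦⟧⁺ 1ˢᵗ ∷ ∈⟦⟧⁺ 2ⁿᵈ ∷ []) , ∣⟦⟧∣ ((y≢u ∷ []) ∷ [] ∷ [])) , yu∉F }) F⇒𝒵)
          (size-exchange (𝒵 K M) F (K ∷ π x v ∷ []) (π y u ∷ []) ((K≢xv ∷ []) ∷ [] ∷ [])
            (λ { 0ᵗʰ → cherry-K∈F , K∉𝒵 ; 1ˢᵗ → xv , xv∉𝒵 }) 𝒵⇒F)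

  -- Two pairs through one vertex, and the case distinction

  opaque
    -- Members avoiding `x` contain `y` and `u`, and those avoiding `y` contain `x` and `u`.
    -- Exchange at `x` and at `y` then makes each of the two link lists of `u` longer than the
    -- other.
    no-lone-cherry : ∀ {x y u} → x ≢ y → x ≢ u → y ≢ u → π x y ∈ F → π x u ∈ F → π y u ∉ F →
      (∀ {v} → v ≢ y → v ≢ u → π x v ∉ F) → Absurd
    no-lone-cherry {x} {y} {u} x≢y x≢u y≢u xy xu yu∉ only =
      <⇒≱ x-count (≤-trans (n≤1+n _) y-count)
      where
      u-centre : ∀ {S} → S ∈ F → y ∉ₛ S → u ∈ₛ S
      u-centre {S} S∈ y∉ with u ∈ₛ? S
      ... | yes u∈ = u∈
      ... | no u∉ with pair-hits (subst (_∈ F) (π-swap x y) xy) S∈ y∉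
      ...   | x∈ with vertex-beside S∈ x∈
      ...     | p , p∈ , p≢x with further-element (x∈ ∷ p∈ ∷ [])
                    (λ { refl → only (λ { refl → y∉ p∈ }) (λ { refl → u∉ p∈ }) S∈ })
      ...       | q , q∈ , (q≢x ∷ q≢p ∷ []) with triple S∈ (≢-sym p≢x) (≢-sym q≢x) (≢-sym q≢p) x∈ p∈ q∈
      -- The member `τ x p q` gives three missing sets at `x`, but a member avoiding `x` contains
      -- `y`, `u` and one of `p`, `q`: two candidates.
      ...         | refl = ⊥-elim (<⇒≱ ≤-refl (exchange-pairs x
                    ((≢-sym p≢x ∷ ≢-sym q≢x ∷ []) ∷ (≢-sym q≢p ∷ []) ∷ [] ∷ [])
                    ((xx∈H xy , no-singleton x) ∷ missing p∈ ∷ missing q∈ ∷ []) cover))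
        where
        missing : ∀ {v} → v ∈ₛ S → Missing x v
        missing v∈ = pair∈H S∈ x∈ v∈ , only (λ { refl → y∉ v∈ }) (λ { refl → u∉ v∈ })
        cover : Covers x (τ y u p ∷ τ y u q ∷ [])
        cover {T} T∈ x∉ with meets-list (x ∷ p ∷ q ∷ []) S∈ T∈
        ... | _ , 0ᵗʰ , x∈T = ⊥-elim (x∉ x∈T)
        ... | _ , 1ˢᵗ , p∈T = here (triple T∈ y≢u (λ { refl → y∉ p∈ }) (λ { refl → u∉ p∈ })
                                (pair-hits xy T∈ x∉) (pair-hits xu T∈ x∉) p∈T)
        ... | _ , 2ⁿᵈ , q∈T = there (here (triple T∈ y≢u (λ { refl → y∉ q∈ }) (λ { refl → u∉ q∈ })
                                (pair-hits xy T∈ x∉) (pair-hits xu T∈ x∉) q∈T))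

      x-count : length (links x y u) < length (links y x u)
      x-count = subst (suc (length (links x y u)) ≤_) (length-map (τ y u) (links y x u))
        (exchange-pairs x (All.tabulate (λ w∈ → proj₁ (proj₂ (links⁻ x y u w∈))) ∷ links-unique x y u)
          ((xx∈H xy , no-singleton x) ∷ All.tabulate λ w∈ → let _ , _ , y≢w , u≢w = links⁻ x y u w∈ in
            links-pair∈H x y u w∈ , only (≢-sym y≢w) (≢-sym u≢w))
          λ S∈ x∉ → link-member (≢-sym y≢u) S∈ (pair-hits xy S∈ x∉) x∉ (pair-hits xu S∈ x∉) λ { refl → yu∉ S∈ })

      yu∈H : π y u ∈ H
      yu∈H with avoid x
      ... | T , T∈ , x∉ = pair∈H T∈ (pair-hits xy T∈ x∉) (pair-hits xu T∈ x∉)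

      cover-y : Covers y (π x u ∷ map (τ x u) (links x y u))
      cover-y {S} S∈ y∉ with S ≟ˢ π x u
      ... | yes eq = here eq
      ... | no S≢ = there (link-member (≢-sym x≢u) S∈ (pair-hits (subst (_∈ F) (π-swap x y) xy) S∈ y∉) y∉ (u-centre S∈ y∉) S≢)

      y-count : length (links y x u) < length (links x y u)
      -- The singleton of `y` and `π y u` are missing besides the links, against the one additional
      -- candidate `π x u`.
      y-count = ≤-pred (subst (2 + length (links y x u) ≤_) (cong suc (length-map (τ x u) (links x y u)))
        (exchange-pairs y
          ((y≢u ∷ All.tabulate (λ w∈ → proj₁ (proj₂ (links⁻ y x u w∈))))
            ∷ All.tabulate (λ w∈ → proj₂ (proj₂ (proj₂ (links⁻ y x u w∈)))) ∷ links-unique y x u)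
          ((pair∈H xy (∈⟦⟧⁺ 1ˢᵗ) (∈⟦⟧⁺ 1ˢᵗ) , no-singleton y) ∷ (yu∈H , yu∉)
            ∷ All.tabulate λ w∈ → let _ , y≢w , x≢w , u≢w = links⁻ y x u w∈ in
              links-pair∈H y x u w∈ , pair-missed xu (∉π (≢-sym x≢y) y≢u) (∉π (≢-sym x≢w) (≢-sym u≢w)))
          cover-y))

  opaque
    two-pairs : ∀ {x y u} → x ≢ y → x ≢ u → y ≢ u → π x y ∈ F → π x u ∈ F → Exceptional H F
    two-pairs {x} {y} {u} x≢y x≢u y≢u xy xu with mem? F (π y u)
    ... | yes yu = triangle-exceptional record { x≢y = x≢y ; x≢u = x≢u ; y≢u = y≢u ; xy = xy ; xu = xu ; yu = yu }
    ... | no yu∉ with anyFin? (λ v → ¬? (v ≟ᶠ y) ×-dec ¬? (v ≟ᶠ u) ×-dec mem? F (π x v))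
    ...   | no none = ⊥-elim (no-lone-cherry x≢y x≢u y≢u xy xu yu∉ λ v≢y v≢u xv → none (_ , v≢y , v≢u , xv))
    ...   | yes (v , v≢y , v≢u , xv) = cherry-exceptional record
      { distinct = (x≢y ∷ x≢u ∷ (λ { refl → no-singleton x xv }) ∷ [])
          ∷ (y≢u ∷ ≢-sym v≢y ∷ []) ∷ (≢-sym v≢u ∷ []) ∷ [] ∷ []
      ; xy = xy ; xu = xu ; xv = xv }

  opaque
    -- Without pairs `F` is 3-uniform; `i` yields a member of it through `avoid`. A pair in `F`
    -- either shares a vertex with a second one or, as all members meet it, gives a `Crossing`.
    exceptional : Fin n → Exceptional H F
    exceptional i with anyFin? (λ x → anyFin? (λ y → mem? F (π x y)))
    ... | no none = ⊥-elim (Uniform.not-uniform (λ a b ab → none (a , b , ab)) (proj₁ (proj₂ (avoid i))))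
    ... | yes (x , y , xy) with x ≟ᶠ y
    ...   | yes refl = ⊥-elim (no-singleton x xy)
    ...   | no x≢y with anyFin? (λ u → ¬? (u ≟ᶠ y) ×-dec mem? F (π x u))
                      | anyFin? (λ u → ¬? (u ≟ᶠ x) ×-dec mem? F (π y u))
    ...     | yes (u , u≢y , xu) | _ = two-pairs x≢y (λ { refl → no-singleton x xu }) (≢-sym u≢y) xy xu
    ...     | no _ | yes (u , u≢x , yu) = two-pairs (≢-sym x≢y) (λ { refl → no-singleton y yu }) (≢-sym u≢x)
                                            (subst (_∈ F) (π-swap x y) xy) yu
    ...     | no none-x | no none-y = ⊥-elim (no-crossing record
      { x≠y = x≢y
      ; no-x = λ v≢y xv → none-x (_ , v≢y , xv)
      ; no-y = λ v≢x yv → none-y (_ , v≢x , yv)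
      ; slack = inj₁ λ S∈ x∉ → pair-hits xy S∈ x∉ })

-- Stars and largest intersecting subfamilies

module _ {n : ℕ} (H : Family n) where

  star≤σ : ∀ x → size (star H x) ≤ σ H
  star≤σ x = All.lookup (xs≤max 0 (map (size ∘ star H) (allFin n))) (∈-map⁺ (size ∘ star H) (∈-allFin x))

  opaque
    largest-star : Fin n → ∃[ x ] size (star H x) ≡ σ H
    largest-star i = x , ≤-antisym (star≤σ x)
      -- `z≤n` disposes of the default value 0 in `σ`.
      (max≤v⁺ z≤n (All.map⁺ (f[xs]≤f[argmax] i (allFin n))))
      where
      x : Fin n
      x = argmax (size ∘ star H) i (allFin n)

  star-intersecting : ∀ x → IntersectingSubfamily H (star H x)
  star-intersecting x = proj₁ , λ (_ , x∈A) (_ , x∈B) → x , x∈p∩q⁺ (x∈A , x∈B)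

  ⊆star⇒size≤ : ∀ {F x} → F ⊆ star H x → size F ≤ size (star H x)
  ⊆star⇒size≤ {F} {x} F⊆ = +-cancelʳ-≤ 0 _ _
    (size-exchange F (star H x) [] [] [] (λ ()) (λ S∈ → inj₁ (F⊆ S∈)))

  ⊆star∧large⇒≐ : ∀ {F x} → F ⊆ star H x → size (star H x) ≤ size F → F ≐ star H x
  ⊆star∧large⇒≐ {F} {x} F⊆ large = F⊆ , λ {S} S∈ → decidable-stable (mem? F S) λ S∉F →
    <⇒≱ (subst (_≤ size (star H x) + 0) (+-comm (size F) 1)
          (size-exchange F (star H x) (S ∷ []) [] ([] ∷ []) (λ { 0ᵗʰ → S∈ , S∉F }) (λ T∈ → inj₁ (F⊆ T∈))))
        (≤-trans (≤-reflexive (+-identityʳ (size (star H x)))) large)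

module _ {n : ℕ} (H : Family n) (rank : H ⊆ atMost n 3) (down : Downset H) (i : Fin n) where

  star-or-exceptional : ∀ {F} → IntersectingSubfamily H F → (∀ x → size (star H x) ≤ size F) →
                        (∃[ x ] F ⊆ star H x) ⊎ Exceptional H F
  star-or-exceptional {F} (F⊆H , int) large with anyFin? (λ x → ¬? (avoided? x))
    where
    avoided? : ∀ x → Dec (∃[ S ] S ∈ F × x ∉ₛ S)
    avoided? x = anySubset? (λ S → mem? F S ×-dec ¬? (x ∈ₛ? S))
  ... | yes (x , none) = inj₁ (x , λ {S} S∈ →
          F⊆H S∈ , decidable-stable (x ∈ₛ? S) λ x∉ → none (S , S∈ , x∉))
  ... | no none = inj₂ (NonStar.exceptional H F rank down F⊆H int large
          (λ x → decidable-stable (anySubset? (λ S → mem? F S ×-dec ¬? (x ∈ₛ? S))) λ ¬p → none (x , ¬p)) i)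

  -- An `F` larger than `σ H` is as large as every star, so the dichotomy applies; in both of its
  -- cases some star is at least as large as `F`.
  intersecting≤σ : ∀ F → IntersectingSubfamily H F → size F ≤ σ H
  intersecting≤σ F sub = ≮⇒≥ λ σ<F → <⇒≱ σ<F
    (bound (star-or-exceptional sub λ x → ≤-trans (star≤σ H x) (<⇒≤ σ<F)))
    where
    bound : (∃[ x ] F ⊆ star H x) ⊎ Exceptional H F → size F ≤ σ H
    bound (inj₁ (x , F⊆)) = ≤-trans (⊆star⇒size≤ H {F} F⊆) (star≤σ H x)
    bound (inj₂ (_ , _ , _ , _ , _ , _ , _ , x , F≤)) = ≤-trans F≤ (star≤σ H x)

  downset-EKR : EKR H
  downset-EKR with largest-star H i
  ... | x , eq = star H x
      , (star-intersecting H x , λ F sub → ≤-trans (intersecting≤σ F sub) (≤-reflexive (sym eq)))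
      , eq

  largest-size : ∀ {F} → LargestIntersecting H F → size F ≡ σ H
  largest-size {F} (sub , largest) with largest-star H i
  ... | x , eq = ≤-antisym (intersecting≤σ F sub)
      (≤-trans (≤-reflexive (sym eq)) (largest (star H x) (star-intersecting H x)))

  largest-is-star : ∀ G → LargestIntersecting H G → (∃[ x ] G ≐ star H x) ⊎ Exceptional H G
  largest-is-star G (sub , largest) = Sum.map₁ (λ (x , G⊆) → x , ⊆star∧large⇒≐ H {G} G⊆ (large x))
    (star-or-exceptional sub large)
    where
    large : ∀ x → size (star H x) ≤ size G
    large x = largest (star H x) (star-intersecting H x)

-- The first exception is never used: it is the case |M| = 1 of the second.
theorem1p4 : (n : ℕ) → n ≥ 1 → (H : Family n) → H ⊆ atMost n 3 → Downset H →
    EKR H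
    × (¬ ( (∃[ K ] ∣ K ∣ ≡ 4
    × binom K 3 ⊆ H
    × (∀ A → A ∈ H → A ⊆ₛ K ⊎ Empty (K ∩ A))
    × σ H ≡ 7)
    ⊎ (∃[ K ] ∃[ M ] ∣ K ∣ ≡ 3
    × M ⊆ₛ ∁ K
    × 𝒵 K M ⊆ H
    × ( (K ∉ H × σ H ≡ size (𝒵 K M) × size (𝒵 K M) ≡ 3 * ∣ M ∣ + 3)
    ⊎ (K ∈ H × σ H ≡ size (𝒵 K M) + 1 × size (𝒵 K M) + 1 ≡ 3 * ∣ M ∣ + 4))))
    → StrictlyEKR H)
theorem1p4 n n≥1 H rank down = downset-EKR H rank down i , λ not-exceptional →
  downset-EKR H rank down i , λ G largest →
    [ id
    , (λ (K , M , ∣K∣ , M⊆ , 𝒵⊆ , ∣𝒵∣ , sizes , _) → ⊥-elim (not-exceptional (inj₂ (K , M , ∣K∣ , M⊆ , 𝒵⊆ ,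
        Sum.map (λ (K∉ , ∣G∣) → K∉ , trans (sym (largest-size H rank down i {G} largest)) ∣G∣ , ∣𝒵∣)
                (λ (K∈ , ∣G∣) → K∈ , trans (sym (largest-size H rank down i {G} largest)) ∣G∣ ,
                  trans (cong (_+ 1) ∣𝒵∣) (+-assoc (3 * ∣ M ∣) 3 1))
                sizes))))
    ]′ (largest-is-star H rank down i G largest)
  where
  i : Fin n
  i = fromℕ< n≥1
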